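{- Let $X\subseteq U$ be a fixed set of $|X|=m$ keys and let $h:U\to[n]$ be a simple tabulation hash function. Then with high probability $$|h(X)|\ge n\left(1-\left(1-\frac1n\right)^{\Omega(m)}\right);$$ that is, for every constant $\gamma>0$ there is a constant $\beta>0$ (depending only on $\gamma$ and $c$) such that $|h(X)|\ge n\left(1-(1-1/n)^{m/\beta}\right)$ with probability at least $1-O(n^{ -\gamma})$.
   Context: Simple tabulation hashing: the key universe is $U=[u]$, each key $x\in U$ is viewed as a vector $(x[0],\dots,x[c-1])$ of $c=O(1)$ characters from $\Sigma=[u^{1/c}]$; the range is $[n]=[2^r]$. $h(x)=h_0(x[0])\oplus\cdots\oplus h_{c-1}(x[c-1])$ with $h_0,\dots,h_{c-1}:\Sigma\to[2^r]$ independent fully random functions and $\oplus$ bitwise XOR. "With high probability" means with probability $1-O(n^{ -\gamma})$ for any prescribed constant $\gamma>0$. -}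

module Defs where

open import Algebra.Definitions.RawSemiring using () renaming (_^_ to pow)
open import Data.Bool.Base using (_xor_)
open import Data.Fin.Base using (Fin; zero; finToFun; funToFin)
open import Data.Fin.Properties using (_≟_; any?; 2↔Bool)
open import Data.Fin.Subset using (Subset; ∣_∣)
open import Data.Fin.Subset.Properties using (_∈?_)
open import Data.Integer.Base as ℤ using (+_)
open import Data.List.Base using (length; filter; allFin)
open import Data.Nat.Base as ℕ using (ℕ; NonZero)
open import Data.Nat.Properties using (m^n≢0)
open import Data.Product.Base using (∃-syntax; _×_)
open import Data.Rational.Base using (ℚ; 0ℚ; 1ℚ; _/_; _÷_; _-_; _*_; _≤_; _<_; ↥_; ↧ₙ_; Positive; +-*-rawSemiring)
open import Data.Rational.Properties using (_≤?_; pos⇒nonZero)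
open import Data.Sum.Base using (_⊎_)
open import Data.Vec.Base using (tabulate)
open import Data.Vec.Functional using (foldr)
open import Function.Bundles using (Inverse)
open import Level using (0ℓ)
open import Relation.Nullary using (¬_; does)
open import Relation.Nullary.Decidable using (_×-dec_)
open import Relation.Unary using (Pred; Decidable)

-- Dedekind reals: L q means q < x, and U q means x < q.
record ℝ : Set₁ where
  field
    L U         : Pred ℚ 0ℓ
    L-inhabited : ∃[ q ] L q
    U-inhabited : ∃[ q ] U q
    L-closed    : ∀ {p q} → p < q → L q → L p
    L-open      : ∀ {p} → L p → ∃[ q ] (p < q × L q)
    U-closed    : ∀ {p q} → p < q → U p → U q
    U-open      : ∀ {q} → U q → ∃[ p ] (p < q × U p)
    disjoint    : ∀ {q} → ¬ (L q × U q)
    located     : ∀ {p q} → p < q → L p ⊎ U q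

0<ℝ_ : ℝ → Set
0<ℝ x = ℝ.L x 0ℚ

fromℕ : ℕ → ℚ
fromℕ k = + k / 1

infixr 8 _^_
_^_ : ℚ → ℕ → ℚ
_^_ = pow +-*-rawSemiring

infix 4 _≤_·_^ℚ_ _≤_·_^ℝ_

-- x ≤ k · bᵃᐟᵈ for x, k, b ≥ 0 and ρ = a/d ≥ 0, both sides raised to the
-- power d since the root need not be rational; 0⁰ = 1.
_≤_·_^ℚ_ : (x k b ρ : ℚ) → Set
x ≤ k · b ^ℚ ρ = x ^ ↧ₙ ρ ≤ (k ^ ↧ₙ ρ) * (b ^ ℤ.∣ ↥ ρ ∣)

-- x ≤ k · b^γ for x, k ≥ 0, 0 < b ≤ 1 and real γ > 0, where
-- b^γ = inf { b^ρ | ρ rational, 0 ≤ ρ < γ }.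
_≤_·_^ℝ_ : (x k b : ℚ) (γ : ℝ) → Set
x ≤ k · b ^ℝ γ = ∀ ρ → 0ℚ ≤ ρ → ℝ.L γ ρ → x ≤ k · b ^ℚ ρ

-- Probability of an event under the uniform distribution on Fin N.
Pr : ∀ {N} .{{_ : NonZero N}} {E : Pred (Fin N) 0ℓ} → Decidable E → ℚ
Pr {N} E? = + length (filter E? (allFin N)) / N

image : ∀ {u n} → (Fin u → Fin n) → Subset u → Subset n
image h X = tabulate λ y → does (any? λ x → (x ∈? X) ×-dec (h x ≟ y))

xor₂ : Fin 2 → Fin 2 → Fin 2
xor₂ a b = from (to a xor to b)
  where open Inverse 2↔Bool

module Tabulation (c σ r : ℕ) where

  n u : ℕ
  n = 2 ℕ.^ r
  u = σ ℕ.^ c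

  instance
    n≢0 : NonZero n
    n≢0 = m^n≢0 2 r

  -- Bitwise XOR of r-bit numbers.
  infixr 6 _⊕_
  _⊕_ : Fin n → Fin n → Fin n
  v ⊕ w = funToFin {r} λ k → xor₂ (finToFun v k) (finToFun w k)

  0ₙ : Fin n
  0ₙ = funToFin {r} λ _ → zero

  -- x [ i ] is the i-th base-σ digit of x.
  _[_] : Fin u → Fin c → Fin σ
  x [ i ] = finToFun x i

  hash : (Fin c → Fin σ → Fin n) → Fin u → Fin n
  hash t x = foldr _⊕_ 0ₙ λ i → t i (x [ i ])

  -- The sample space Fin ((n ^ σ) ^ c) is in bijection with the c-tuples of
  -- functions Fin σ → Fin n; its uniform distribution makes the c functions
  -- independent and fully random.
  |Ω| : ℕ
  |Ω| = (n ℕ.^ σ) ℕ.^ c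

  instance
    |Ω|≢0 : NonZero |Ω|
    |Ω|≢0 = m^n≢0 (n ℕ.^ σ) c {{m^n≢0 n σ}}

  tables : Fin |Ω| → Fin c → Fin σ → Fin n
  tables ω i = finToFun (finToFun ω i)

  h : Fin |Ω| → Fin u → Fin n
  h ω = hash (tables ω)

  1/n : ℚ
  1/n = + 1 / n

  -- |h(X)| ≥ n (1 - (1 - 1/n)^(m/β)), rearranged to
  -- n - |h(X)| ≤ n · (1 - 1/n)^(m/β).
  LargeImage : (β : ℚ) .{{_ : Positive β}} (m : ℕ) → Subset u → Pred (Fin |Ω|) 0ℓ
  LargeImage β m X ω =
    fromℕ n - fromℕ ∣ image (h ω) X ∣ ≤ fromℕ n · 1ℚ - 1/n ^ℚ (fromℕ m ÷ β) {{pos⇒nonZero β}}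

  largeImage? : (β : ℚ) .{{_ : Positive β}} (m : ℕ) (X : Subset u) → Decidable (LargeImage β m X)
  largeImage? β m X ω = _ ≤? _

  -- p ≥ 1 - K n^(-γ), rearranged to 1 - p ≤ K · (1/n)^γ.
  _≥1-_·n^-_ : (p K : ℚ) (γ : ℝ) → Set
  p ≥1- K ·n^- γ = 1ℚ - p ≤ K · 1/n ^ℝ γ

{-# OPTIONS --safe #-}

-- Put n = 2^r, L = 6c and Q = 2^⌊r/L⌋, so that Q is about n^(1/L).
--
-- Maximum load: by induction on the number of characters, a set of at most
-- n/2Q keys puts O(1) keys in every bin with high probability.  Given the
-- other tables, the groups of keys sharing a first character are shifted
-- independently, and the number of groups hitting a fixed bin has a bounded
-- exponential moment to the base Q.  This settles sets of at most n/2Q keys.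
--
-- For larger sets of at most Q^(L+2) keys, call a character at position i
-- light if at most τ = Q^(L−4) keys contain it there.  Counting heavy
-- characters gives a position i at which at least a 1/2c fraction of the keys
-- have a light character.  With the tables at the other positions fixed, the
-- groups of these keys are sets of size at most τ, each of size comparable to
-- its number of keys, that are shifted independently.  A shift covers on
-- average a b/n fraction of the s uncovered bins, where b is the size of the
-- set, so E[sᵗ] shrinks by a factor 1 − tb/2n as long as s ≥ tτ.  If the
-- target n(1 − 1/n)^(m/β) is at least tτ, then Markov's inequality for sᵗ with
-- t about Q² gives a failure probability of at most 2^(−Q); otherwise the
-- first moment shows that no bin stays empty.  Even larger sets are replaced
-- by a subset.
module Submission where

open import Defs renaming (_^_ to _^ℚ_)
open import Algebra.Bundles using (CommutativeMonoid)
open import Data.Bool.Base using (true; false; if_then_else_)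
open import Data.Fin.Base using (Fin; zero; suc; combine; _↑ˡ_; _↑ʳ_; finToFun; funToFin)
import Data.Fin.Properties as Fin
open import Data.Fin.Subset using (Subset; ∣_∣; _⊆_; inside; outside) renaming (_∈_ to _∈ₛ_)
open import Data.Fin.Subset.Properties using (_∈?_; s⊆s; out⊆; ∣p∣≤n)
import Data.Integer.Base as ℤ
import Data.Integer.Properties as ℤ
open import Data.List.Base using (List; []; _∷_; _++_; map; concatMap; length; filter; allFin)
open import Data.List.Membership.Propositional using (_∈_)
open import Data.List.Membership.Propositional.Properties using (∈-allFin)
open import Data.List.Properties using (map-tabulate; length-tabulate) renaming (length-filter to length-filter-≤)
open import Data.List.Relation.Unary.Any using (here; there)
open import Data.Nat.Base
open import Data.Nat.Coprimality using (1-coprimeTo) renaming (sym to coprime-sym)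
open import Data.Nat.DivMod using (m%n<n; m≡m%n+[m/n]*n; /-monoˡ-≤; m*n/n≡m)
open import Data.Nat.Properties
open import Data.Nat.Tactic.RingSolver using (solve-∀)
open import Data.Product.Base using (∃-syntax; Σ-syntax; _×_; _,_; proj₁; proj₂)
open import Data.Rational.Base as ℚ using (ℚ; mkℚ; 0ℚ; 1ℚ; Positive; ↥_; ↧_; ↧ₙ_; toℚᵘ)
import Data.Rational.Properties as ℚ
import Data.Rational.Unnormalised.Base as ℚᵘ
import Data.Rational.Unnormalised.Properties as ℚᵘ
open import Data.Vec.Base using (Vec; []; _∷_; lookup; tabulate; replicate; _[_]≔_)
open import Data.Vec.Functional using (foldr)
open import Data.Vec.Properties using (tabulate-cong; tabulate∘lookup; lookup∘tabulate; lookup-replicate)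
open import Function.Base using (_∘_; id; _$_)
open import Level using (0ℓ)
open import Relation.Binary.PropositionalEquality using (_≡_; refl; sym; trans; cong; cong₂; subst; subst₂; module ≡-Reasoning)
open import Relation.Nullary using (Dec; yes; no; does; ¬_; contradiction)
open import Relation.Nullary.Decidable using (_×-dec_)
open import Relation.Unary using (Pred; Decidable)

-- Finite sums and products

-- Distinct keys have dependent hash values; a set of keys sharing a character at one position moves
-- as a rigid block. How many bins a block covers is settled by the other tables, which is why the
-- maximum load is treated first: otherwise a block could collapse to a few bins. Very large blocks
-- are the other obstacle, since a single shift could then decide the outcome; hence the restriction
-- to light characters. The target may be far smaller than n, so a deviation bound on an additive
-- scale would be too weak. A high moment sᵗ works on a multiplicative scale, but only while one
-- shift removes at most the fraction 1/t of s, and the cutoff s ≥ tτ guarantees this. Probabilities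
-- are counts of table tuples, and inequalities are cleared of denominators and roots, so that
-- everything before the final translation to ℚ takes place in ℕ.

private variable
  I I′ : Set
  Φ Ψ : Set

𝟙 : Dec Φ → ℕ
𝟙 d = if does d then 1 else 0

𝟙≤1 : (d : Dec Φ) → 𝟙 d ≤ 1
𝟙≤1 (yes _) = ≤-refl
𝟙≤1 (no _)  = z≤n

𝟙-yes : (d : Dec Φ) → Φ → 𝟙 d ≡ 1
𝟙-yes (yes _) _ = refl
𝟙-yes (no ¬p) p = contradiction p ¬p

𝟙-no : (d : Dec Φ) → ¬ Φ → 𝟙 d ≡ 0
𝟙-no (yes p) ¬p = contradiction p ¬p
𝟙-no (no _)  _  = refl

𝟙-≤ : (d : Dec Φ) {k : ℕ} → (Φ → 1 ≤ k) → 𝟙 d ≤ k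
𝟙-≤ (yes p) f = f p
𝟙-≤ (no _)  _ = z≤n

𝟙*-≤ : (d : Dec Φ) {j k : ℕ} → (Φ → j ≤ k) → 𝟙 d * j ≤ k
𝟙*-≤ (yes p) f = ≤-trans (≤-reflexive (+-identityʳ _)) (f p)
𝟙*-≤ (no _)  _ = z≤n

𝟙-cong : (d : Dec Φ) (e : Dec Ψ) → (Φ → Ψ) → (Ψ → Φ) → 𝟙 d ≡ 𝟙 e
𝟙-cong (yes p) e f _ = sym (𝟙-yes e (f p))
𝟙-cong (no ¬p) e _ g = sym (𝟙-no e (¬p ∘ g))

∑ : List I → (I → ℕ) → ℕ
∑ []       f = 0
∑ (x ∷ xs) f = f x + ∑ xs f

∑-syntax = ∑
infix 5 ∑-syntax
syntax ∑-syntax xs (λ x → e) = ∑[ x ∈ xs ] e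

∑-cong : (xs : List I) {f g : I → ℕ} → (∀ x → f x ≡ g x) → ∑ xs f ≡ ∑ xs g
∑-cong []       e = refl
∑-cong (x ∷ xs) e = cong₂ _+_ (e x) (∑-cong xs e)

∑-mono : (xs : List I) {f g : I → ℕ} → (∀ x → f x ≤ g x) → ∑ xs f ≤ ∑ xs g
∑-mono []       e = z≤n
∑-mono (x ∷ xs) e = +-mono-≤ (e x) (∑-mono xs e)

∑-distrib-+ : (xs : List I) (f g : I → ℕ) → (∑[ x ∈ xs ] (f x + g x)) ≡ ∑ xs f + ∑ xs g
∑-distrib-+ []       f g = refl
∑-distrib-+ (x ∷ xs) f g = trans (cong (_ +_) (∑-distrib-+ xs f g)) (rearrange (f x) (g x) (∑ xs f) (∑ xs g))
  where
  rearrange : ∀ a b c d → a + b + (c + d) ≡ a + c + (b + d)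
  rearrange = solve-∀

*-distribˡ-∑ : (k : ℕ) (xs : List I) (f : I → ℕ) → (∑[ x ∈ xs ] (k * f x)) ≡ k * ∑ xs f
*-distribˡ-∑ k []       f = sym (*-zeroʳ k)
*-distribˡ-∑ k (x ∷ xs) f = trans (cong (_ +_) (*-distribˡ-∑ k xs f)) (sym (*-distribˡ-+ k _ _))

*-distribʳ-∑ : (k : ℕ) (xs : List I) (f : I → ℕ) → (∑[ x ∈ xs ] (f x * k)) ≡ ∑ xs f * k
*-distribʳ-∑ k xs f = trans (∑-cong xs λ x → *-comm (f x) k) (trans (*-distribˡ-∑ k xs f) (*-comm k _))

∑-zero : (xs : List I) {f : I → ℕ} → (∀ x → f x ≡ 0) → ∑ xs f ≡ 0
∑-zero []       e = refl
∑-zero (x ∷ xs) e = cong₂ _+_ (e x) (∑-zero xs e)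

∑-const : (xs : List I) (k : ℕ) → (∑[ _ ∈ xs ] k) ≡ length xs * k
∑-const []       k = refl
∑-const (_ ∷ xs) k = cong (k +_) (∑-const xs k)

∑-swap : (xs : List I) (ys : List I′) (f : I → I′ → ℕ) →
  (∑[ x ∈ xs ] ∑[ y ∈ ys ] f x y) ≡ (∑[ y ∈ ys ] ∑[ x ∈ xs ] f x y)
∑-swap []       ys f = sym (∑-zero ys λ _ → refl)
∑-swap (x ∷ xs) ys f = trans (cong (_ +_) (∑-swap xs ys f)) (sym (∑-distrib-+ ys _ _))

∑-map : (h : I → I′) (xs : List I) (f : I′ → ℕ) → ∑ (map h xs) f ≡ ∑ xs (f ∘ h)
∑-map h []       f = refl
∑-map h (x ∷ xs) f = cong (_ +_) (∑-map h xs f)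

∑-++ : (xs ys : List I) (f : I → ℕ) → ∑ (xs ++ ys) f ≡ ∑ xs f + ∑ ys f
∑-++ []       ys f = refl
∑-++ (x ∷ xs) ys f = trans (cong (_ +_) (∑-++ xs ys f)) (sym (+-assoc (f x) _ _))

∑-concatMap : (h : I → List I′) (xs : List I) (f : I′ → ℕ) →
  ∑ (concatMap h xs) f ≡ (∑[ x ∈ xs ] ∑ (h x) f)
∑-concatMap h []       f = refl
∑-concatMap h (x ∷ xs) f = trans (∑-++ (h x) _ f) (cong (_ +_) (∑-concatMap h xs f))

∈⇒≤∑ : {xs : List I} {x : I} (f : I → ℕ) → x ∈ xs → f x ≤ ∑ xs f
∈⇒≤∑ f (here refl) = m≤m+n _ _
∈⇒≤∑ f (there x∈) = ≤-trans (∈⇒≤∑ f x∈) (m≤n+m _ _)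

0<∑⇒∃ : (xs : List I) (f : I → ℕ) → 0 < ∑ xs f → ∃[ x ] 0 < f x
0<∑⇒∃ (x ∷ xs) f 0<s with f x in eq
... | suc _ = x , subst (0 <_) (sym eq) z<s
... | zero  = 0<∑⇒∃ xs f 0<s

length-filter : {E : Pred I 0ℓ} (E? : Decidable E) (xs : List I) →
  length (filter E? xs) ≡ (∑[ x ∈ xs ] 𝟙 (E? x))
length-filter E? [] = refl
length-filter E? (x ∷ xs) with does (E? x)
... | true  = cong suc (length-filter E? xs)
... | false = length-filter E? xs

∑-allFin-suc : (k : ℕ) (f : Fin (suc k) → ℕ) → ∑ (allFin (suc k)) f ≡ f zero + ∑ (allFin k) (f ∘ suc)
∑-allFin-suc k f = cong (f zero +_) (trans (cong (λ l → ∑ l f) (sym (map-tabulate id suc))) (∑-map suc (allFin k) f))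

length-allFin : (k : ℕ) → length (allFin k) ≡ k
length-allFin k = length-tabulate {n = k} id

∑-allFin-const : (k j : ℕ) → (∑[ _ ∈ allFin k ] j) ≡ k * j
∑-allFin-const k j = trans (∑-const (allFin k) j) (cong (_* j) (length-allFin k))

δ : ∀ {k} → Fin k → Fin k → ℕ
δ x y = 𝟙 (x Fin.≟ y)

∑-δ : ∀ {k} (x : Fin k) (f : Fin k → ℕ) → (∑[ y ∈ allFin k ] (δ x y * f y)) ≡ f x
∑-δ {suc k} zero f = begin
  (∑[ y ∈ allFin (suc k) ] (δ zero y * f y))    ≡⟨ ∑-allFin-suc k _ ⟩
  1 * f zero + (∑[ y ∈ allFin k ] (δ zero (suc y) * f (suc y)))
    ≡⟨ cong₂ _+_ (+-identityʳ _) (∑-zero (allFin k) λ _ → refl) ⟩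
  f zero + 0                                    ≡⟨ +-identityʳ _ ⟩
  f zero                                        ∎
  where open ≡-Reasoning
∑-δ {suc k} (suc x) f = begin
  (∑[ y ∈ allFin (suc k) ] (δ (suc x) y * f y)) ≡⟨ ∑-allFin-suc k (λ y → δ (suc x) y * f y) ⟩
  (∑[ y ∈ allFin k ] (δ (suc x) (suc y) * f (suc y)))
    ≡⟨ ∑-cong (allFin k) (λ y → cong (_* f (suc y)) (𝟙-cong (suc x Fin.≟ suc y) (x Fin.≟ y) Fin.suc-injective (cong suc))) ⟩
  (∑[ y ∈ allFin k ] (δ x y * f (suc y)))       ≡⟨ ∑-δ x (f ∘ suc) ⟩
  f (suc x)                                     ∎
  where open ≡-Reasoning

∑-δ-1 : ∀ {k} (x : Fin k) → (∑[ y ∈ allFin k ] δ x y) ≡ 1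
∑-δ-1 {k} x = trans (∑-cong (allFin k) λ y → sym (*-identityʳ _)) (∑-δ x λ _ → 1)

∏ : (k : ℕ) → (Fin k → ℕ) → ℕ
∏ zero    f = 1
∏ (suc k) f = f zero * ∏ k (f ∘ suc)

∏-mono : (k : ℕ) {f g : Fin k → ℕ} → (∀ i → f i ≤ g i) → ∏ k f ≤ ∏ k g
∏-mono zero    e = ≤-refl
∏-mono (suc k) e = *-mono-≤ (e zero) (∏-mono k (e ∘ suc))

∏-cong : (k : ℕ) {f g : Fin k → ℕ} → (∀ i → f i ≡ g i) → ∏ k f ≡ ∏ k g
∏-cong zero    e = refl
∏-cong (suc k) e = cong₂ _*_ (e zero) (∏-cong k (e ∘ suc))

vecs : List I → (k : ℕ) → List (Vec I k)
vecs xs zero    = [] ∷ []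
vecs xs (suc k) = concatMap (λ a → map (a ∷_) (vecs xs k)) xs

∑-vecs-suc : (xs : List I) (k : ℕ) (f : Vec I (suc k) → ℕ) →
  ∑ (vecs xs (suc k)) f ≡ (∑[ a ∈ xs ] ∑[ v ∈ vecs xs k ] f (a ∷ v))
∑-vecs-suc xs k f = trans (∑-concatMap _ xs f) (∑-cong xs λ a → ∑-map (a ∷_) (vecs xs k) f)

length≡∑1 : (xs : List I) → length xs ≡ (∑[ _ ∈ xs ] 1)
length≡∑1 xs = trans (sym (*-identityʳ _)) (sym (∑-const xs 1))

length-vecs : (xs : List I) (k : ℕ) → length (vecs xs k) ≡ length xs ^ k
length-vecs xs zero    = refl
length-vecs xs (suc k) = begin
  length (vecs xs (suc k))                ≡⟨ length≡∑1 (vecs xs (suc k)) ⟩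
  (∑[ _ ∈ vecs xs (suc k) ] 1)            ≡⟨ ∑-vecs-suc xs k _ ⟩
  (∑[ _ ∈ xs ] ∑[ _ ∈ vecs xs k ] 1)      ≡⟨ ∑-const xs _ ⟩
  length xs * (∑[ _ ∈ vecs xs k ] 1)      ≡⟨ cong (length xs *_) (trans (sym (length≡∑1 (vecs xs k))) (length-vecs xs k)) ⟩
  length xs * length xs ^ k               ∎
  where open ≡-Reasoning

-- The coordinates of a uniform vector are independent, so the mean of a product of functions of
-- separate coordinates factors. The independence of the table entries enters the load bound here.
∑-vecs-∏ : (xs : List I) (k : ℕ) (f : Fin k → I → ℕ) →
  (∑[ v ∈ vecs xs k ] ∏ k (λ i → f i (lookup v i))) ≡ ∏ k (λ i → ∑ xs (f i))
∑-vecs-∏ xs zero    f = refl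
∑-vecs-∏ xs (suc k) f = begin
  _ ≡⟨ ∑-vecs-suc xs k _ ⟩
  (∑[ a ∈ xs ] ∑[ v ∈ vecs xs k ] (f zero a * ∏ k (λ i → f (suc i) (lookup v i))))
    ≡⟨ ∑-cong xs (λ a → trans (*-distribˡ-∑ (f zero a) (vecs xs k) _) (cong (f zero a *_) (∑-vecs-∏ xs k (f ∘ suc)))) ⟩
  (∑[ a ∈ xs ] (f zero a * ∏ k (λ i → ∑ xs (f (suc i))))) ≡⟨ *-distribʳ-∑ _ xs (f zero) ⟩
  _ ∎
  where open ≡-Reasoning

-- Inequalities between natural numbers

^-distribʳ-* : ∀ k a b → (a * b) ^ k ≡ a ^ k * b ^ k
^-distribʳ-* zero    a b = refl
^-distribʳ-* (suc k) a b = trans (cong (a * b *_) (^-distribʳ-* k a b)) (rearrange a b (a ^ k) (b ^ k))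
  where
  rearrange : ∀ a b x y → a * b * (x * y) ≡ a * x * (b * y)
  rearrange = solve-∀

0^k≡0 : ∀ k .{{_ : NonZero k}} → 0 ^ k ≡ 0
0^k≡0 (suc k) = refl

l≤d*[1⊓l] : ∀ {l d} → l ≤ d → l ≤ d * (1 ⊓ l)
l≤d*[1⊓l] {zero}      _  = z≤n
l≤d*[1⊓l] {suc l} {d} le = ≤-trans le (≤-reflexive (sym (*-identityʳ d)))

1⊓k+[1∸k]≡1 : ∀ k → 1 ⊓ k + (1 ∸ k) ≡ 1
1⊓k+[1∸k]≡1 k = trans (cong (_+ (1 ∸ k)) (⊓-comm 1 k)) (m⊓n+n∸m≡n k 1)

^-∑ : ∀ q k (f : Fin k → ℕ) → q ^ ∑ (allFin k) f ≡ ∏ k (λ i → q ^ f i)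
^-∑ q zero    f = refl
^-∑ q (suc k) f = trans (cong (q ^_) (∑-allFin-suc k f))
  (trans (^-distribˡ-+-* q (f zero) _) (cong (q ^ f zero *_) (^-∑ q k (f ∘ suc))))

^-cancelʳ-≤ : ∀ k .{{_ : NonZero k}} {a b} → a ^ k ≤ b ^ k → a ≤ b
^-cancelʳ-≤ k {a} {b} le with a ≤? b
... | yes a≤b = a≤b
... | no  a≰b = contradiction le (<⇒≱ (^-monoˡ-< k (≰⇒> a≰b)))

-- The induction step rests on (w - j - 1) w ≤ (w - 1)(w - j); for j > w truncated subtraction makes
-- the left side 0. In fractions this is 1 - j/w ≤ (1 - 1/w)^j.
bernoulli-∸ : ∀ w j → (w ∸ j) * w ^ j ≤ w * (w ∸ 1) ^ j
bernoulli-∸ w zero = ≤-refl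
bernoulli-∸ w (suc j) with suc j ≤? w
... | no  j≮w = subst (λ z → z * w ^ suc j ≤ w * (w ∸ 1) ^ suc j) (sym (m≤n⇒m∸n≡0 (≰⇒≥ j≮w))) z≤n
... | yes j<w with w ∸ suc j | m∸n+n≡m j<w
...   | d | refl = begin
  d * (w′ * w′ ^ j)                 ≡⟨ *-assoc d w′ _ ⟨
  d * w′ * w′ ^ j                   ≤⟨ *-monoˡ-≤ (w′ ^ j) step ⟩
  (w′ ∸ 1) * (w′ ∸ j) * w′ ^ j      ≡⟨ *-assoc (w′ ∸ 1) (w′ ∸ j) _ ⟩
  (w′ ∸ 1) * ((w′ ∸ j) * w′ ^ j)    ≤⟨ *-monoʳ-≤ (w′ ∸ 1) (bernoulli-∸ w′ j) ⟩
  (w′ ∸ 1) * (w′ * (w′ ∸ 1) ^ j)    ≡⟨ rearrange (w′ ∸ 1) w′ ((w′ ∸ 1) ^ j) ⟩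
  w′ * ((w′ ∸ 1) * (w′ ∸ 1) ^ j)    ∎
  where
  open ≤-Reasoning
  w′ : ℕ
  w′ = d + suc j
  rearrange : ∀ a b x → a * (b * x) ≡ b * (a * x)
  rearrange = solve-∀
  expand : ∀ d j → (d + j) * suc d ≡ d * (d + suc j) + j
  expand = solve-∀
  step : d * w′ ≤ (w′ ∸ 1) * (w′ ∸ j)
  step = begin
    d * w′                                ≤⟨ m≤m+n _ j ⟩
    d * w′ + j                            ≡⟨ expand d j ⟨
    (d + j) * suc d                       ≡⟨ cong (_* suc d) (cong (_∸ 1) (+-suc d j)) ⟨
    (w′ ∸ 1) * suc d                      ≡⟨ cong (λ z → (w′ ∸ 1) * z) (trans (cong (_∸ j) (+-suc d j)) (m+n∸n≡m (suc d) j)) ⟨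
    (w′ ∸ 1) * (w′ ∸ j)                   ∎

bernoulli-+ : ∀ w j → (w + j) * w ^ j ≤ w * suc w ^ j
bernoulli-+ w zero = ≤-reflexive (cong (_* 1) (+-identityʳ w))
bernoulli-+ w (suc j) = begin
  (w + suc j) * (w * w ^ j)      ≤⟨ m≤m+n _ (j * w ^ j) ⟩
  (w + suc j) * (w * w ^ j) + j * w ^ j ≡⟨ rearrange w j (w ^ j) ⟩
  suc w * ((w + j) * w ^ j)      ≤⟨ *-monoʳ-≤ (suc w) (bernoulli-+ w j) ⟩
  suc w * (w * suc w ^ j)        ≡⟨ rearrange′ w (suc w ^ j) ⟩
  w * (suc w * suc w ^ j)        ∎
  where
  open ≤-Reasoning
  rearrange : ∀ w j x → (w + suc j) * (w * x) + j * x ≡ suc w * ((w + j) * x)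
  rearrange = solve-∀
  rearrange′ : ∀ w x → suc w * (w * x) ≡ w * (suc w * x)
  rearrange′ = solve-∀

-- With k = n - 1, Bernoulli gives (1 + 1/k)^(k+1) ≥ 1 + (k+1)/k ≥ 2. The case n = 1 is split off so
-- that k can be cancelled.
2*[n∸1]^n≤n^n : ∀ n .{{_ : NonZero n}} → 2 * (n ∸ 1) ^ n ≤ n ^ n
2*[n∸1]^n≤n^n (suc zero) = z≤n
2*[n∸1]^n≤n^n (suc k@(suc _)) = *-cancelˡ-≤ k (begin
  k * (2 * k ^ suc k)      ≤⟨ m≤m+n _ (k ^ suc k) ⟩
  k * (2 * k ^ suc k) + k ^ suc k ≡⟨ rearrange k (k ^ suc k) ⟩
  (k + suc k) * k ^ suc k  ≤⟨ bernoulli-+ k (suc k) ⟩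
  k * suc k ^ suc k        ∎)
  where
  open ≤-Reasoning
  rearrange : ∀ k x → k * (2 * x) + x ≡ (k + suc k) * x
  rearrange = solve-∀

[n∸1]^j*2^q≤n^j : ∀ n .{{_ : NonZero n}} q {j} → n * q ≤ j → (n ∸ 1) ^ j * 2 ^ q ≤ n ^ j
[n∸1]^j*2^q≤n^j n q {j} nq≤j = begin
  (n ∸ 1) ^ j * 2 ^ q                        ≡⟨ cong (λ e → (n ∸ 1) ^ e * 2 ^ q) (m+[n∸m]≡n nq≤j) ⟨
  (n ∸ 1) ^ (n * q + i) * 2 ^ q              ≡⟨ cong (_* 2 ^ q) (^-distribˡ-+-* (n ∸ 1) (n * q) i) ⟩
  (n ∸ 1) ^ (n * q) * (n ∸ 1) ^ i * 2 ^ q    ≡⟨ rearrange ((n ∸ 1) ^ (n * q)) ((n ∸ 1) ^ i) (2 ^ q) ⟩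
  2 ^ q * (n ∸ 1) ^ (n * q) * (n ∸ 1) ^ i    ≤⟨ *-mono-≤ main (^-monoˡ-≤ i (m∸n≤m n 1)) ⟩
  n ^ (n * q) * n ^ i                        ≡⟨ ^-distribˡ-+-* n (n * q) i ⟨
  n ^ (n * q + i)                            ≡⟨ cong (n ^_) (m+[n∸m]≡n nq≤j) ⟩
  n ^ j                                      ∎
  where
  open ≤-Reasoning
  i = j ∸ n * q
  rearrange : ∀ a b c → a * b * c ≡ c * a * b
  rearrange = solve-∀
  main : 2 ^ q * (n ∸ 1) ^ (n * q) ≤ n ^ (n * q)
  main = begin
    2 ^ q * (n ∸ 1) ^ (n * q)     ≡⟨ cong (2 ^ q *_) (^-*-assoc (n ∸ 1) n q) ⟨
    2 ^ q * ((n ∸ 1) ^ n) ^ q     ≡⟨ ^-distribʳ-* q 2 _ ⟨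
    (2 * (n ∸ 1) ^ n) ^ q         ≤⟨ ^-monoˡ-≤ q (2*[n∸1]^n≤n^n n) ⟩
    (n ^ n) ^ q                   ≡⟨ ^-*-assoc n n q ⟩
    n ^ (n * q)                   ∎

-- (1 − 1/2n)⁴ ≤ 1 − 1/n
[2n∸1]^4*n≤[2n]^4*[n∸1] : ∀ {n} → 2 ≤ n → (2 * n ∸ 1) ^ 4 * n ≤ (2 * n) ^ 4 * (n ∸ 1)
[2n∸1]^4*n≤[2n]^4*[n∸1] {suc (suc k)} (s≤s (s≤s z≤n)) = begin
  (2 * (2 + k) ∸ 1) ^ 4 * (2 + k)     ≡⟨ cong (λ z → z ^ 4 * (2 + k)) (pred-double k) ⟩
  (2 * k + 3) ^ 4 * (2 + k)           ≤⟨ m≤m+n _ _ ⟩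
  (2 * k + 3) ^ 4 * (2 + k) + (16 * k * k * k + 72 * k * k + 104 * k + 47) * (2 + k) ≡⟨ expand k ⟩
  (2 * (2 + k)) ^ 4 * (1 + k)         ∎
  where
  open ≤-Reasoning
  pred-double : ∀ k → 2 * (2 + k) ∸ 1 ≡ 2 * k + 3
  pred-double k = cong (_∸ 1) (double k)
    where
    double : ∀ k → 2 * (2 + k) ≡ suc (2 * k + 3)
    double = solve-∀
  expand : ∀ k → (2 * k + 3) * ((2 * k + 3) * ((2 * k + 3) * ((2 * k + 3) * 1))) * (2 + k)
    + (16 * k * k * k + 72 * k * k + 104 * k + 47) * (2 + k)
    ≡ 2 * (2 + k) * (2 * (2 + k) * (2 * (2 + k) * (2 * (2 + k) * 1))) * (1 + k)
  expand = solve-∀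

[2n∸1]^e*n^k≤[2n]^e*[n∸1]^k : ∀ {n} → 2 ≤ n → ∀ k {e} → 4 * k ≤ e →
  (2 * n ∸ 1) ^ e * n ^ k ≤ (2 * n) ^ e * (n ∸ 1) ^ k
[2n∸1]^e*n^k≤[2n]^e*[n∸1]^k {n} 2≤n k {e} 4k≤e = begin
  (2 * n ∸ 1) ^ e * n ^ k                              ≡⟨ cong (_* n ^ k) (split (2 * n ∸ 1)) ⟩
  ((2 * n ∸ 1) ^ 4) ^ k * (2 * n ∸ 1) ^ i * n ^ k      ≡⟨ regroup ((2 * n ∸ 1) ^ 4) ((2 * n ∸ 1) ^ i) n ⟩
  ((2 * n ∸ 1) ^ 4 * n) ^ k * (2 * n ∸ 1) ^ i          ≤⟨ *-mono-≤ (^-monoˡ-≤ k ([2n∸1]^4*n≤[2n]^4*[n∸1] 2≤n)) (^-monoˡ-≤ i (m∸n≤m (2 * n) 1)) ⟩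
  ((2 * n) ^ 4 * (n ∸ 1)) ^ k * (2 * n) ^ i            ≡⟨ regroup ((2 * n) ^ 4) ((2 * n) ^ i) (n ∸ 1) ⟨
  ((2 * n) ^ 4) ^ k * (2 * n) ^ i * (n ∸ 1) ^ k        ≡⟨ cong (_* (n ∸ 1) ^ k) (split (2 * n)) ⟨
  (2 * n) ^ e * (n ∸ 1) ^ k                            ∎
  where
  open ≤-Reasoning
  i = e ∸ 4 * k
  split : ∀ a → a ^ e ≡ (a ^ 4) ^ k * a ^ i
  split a = trans (cong (a ^_) (sym (m+[n∸m]≡n 4k≤e)))
    (trans (^-distribˡ-+-* a (4 * k) i) (cong (_* a ^ i) (sym (^-*-assoc a 4 k))))
  regroup : ∀ a b c → a ^ k * b * c ^ k ≡ (a * c) ^ k * b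
  regroup a b c = trans (rearrange (a ^ k) b (c ^ k)) (cong (_* b) (sym (^-distribʳ-* k a c)))
    where
    rearrange : ∀ a b c → a * b * c ≡ a * c * b
    rearrange = solve-∀

-- Since y ≤ n, (n + x₀) y ≤ n (y + x₀): each factor is traded for an increase of y, which stays at
-- most n by hypothesis. With y = n - ∑ xᵢ this is ∏ (1 + xᵢ/n) ≤ 1 / (1 - ∑ xᵢ/n), without
-- exponentials.
∏[n+x]*y≤n^k*n : ∀ n k (x : Fin k → ℕ) y → y + ∑ (allFin k) x ≤ n → ∏ k (λ i → n + x i) * y ≤ n ^ k * n
∏[n+x]*y≤n^k*n n zero    x y le = +-monoˡ-≤ 0 (≤-trans (m≤m+n y 0) le)
∏[n+x]*y≤n^k*n n (suc k) x y le = begin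
  (n + x₀) * p * y       ≡⟨ rearrange (n + x₀) p y ⟩
  p * ((n + x₀) * y)     ≤⟨ *-monoʳ-≤ p step ⟩
  p * (n * (y + x₀))     ≡⟨ rearrange′ p n (y + x₀) ⟩
  n * (p * (y + x₀))     ≤⟨ *-monoʳ-≤ n (∏[n+x]*y≤n^k*n n k (x ∘ suc) (y + x₀) le′) ⟩
  n * (n ^ k * n)        ≡⟨ *-assoc n (n ^ k) n ⟨
  n * n ^ k * n          ∎
  where
  open ≤-Reasoning
  x₀ = x zero
  p = ∏ k (λ i → n + x (suc i))
  rearrange : ∀ a b c → a * b * c ≡ b * (a * c)
  rearrange = solve-∀
  rearrange′ : ∀ a b c → a * (b * c) ≡ b * (a * c)
  rearrange′ = solve-∀
  le′ : y + x₀ + ∑ (allFin k) (x ∘ suc) ≤ n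
  le′ = ≤-trans (≤-reflexive (trans (+-assoc y x₀ _) (cong (y +_) (sym (∑-allFin-suc k x))))) le
  step : (n + x₀) * y ≤ n * (y + x₀)
  step = begin
    (n + x₀) * y       ≡⟨ *-distribʳ-+ y n x₀ ⟩
    n * y + x₀ * y     ≤⟨ +-monoʳ-≤ (n * y) (*-monoʳ-≤ x₀ (≤-trans (m≤m+n y _) le)) ⟩
    n * y + x₀ * n     ≡⟨ cong (n * y +_) (*-comm x₀ n) ⟩
    n * y + n * x₀     ≡⟨ *-distribˡ-+ n y x₀ ⟨
    n * (y + x₀)       ∎

∏[n+x]≤2*n^k : ∀ n .{{_ : NonZero n}} k (x : Fin k → ℕ) → 2 * ∑ (allFin k) x ≤ n →
  ∏ k (λ i → n + x i) ≤ 2 * n ^ k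
∏[n+x]≤2*n^k n k x le = *-cancelʳ-≤ _ _ n (begin
  p * n             ≤⟨ *-monoʳ-≤ p n≤2y ⟩
  p * (2 * y)       ≡⟨ rearrange p y ⟩
  2 * (p * y)       ≤⟨ *-monoʳ-≤ 2 (∏[n+x]*y≤n^k*n n k x y (≤-reflexive (m∸n+n≡m s≤n))) ⟩
  2 * (n ^ k * n)   ≡⟨ *-assoc 2 (n ^ k) n ⟨
  2 * n ^ k * n     ∎)
  where
  open ≤-Reasoning
  p = ∏ k (λ i → n + x i)
  s = ∑ (allFin k) x
  s≤n : s ≤ n
  s≤n = ≤-trans (m≤m+n s _) le
  y = n ∸ s
  rearrange : ∀ a b → a * (2 * b) ≡ 2 * (a * b)
  rearrange = solve-∀
  n≤2y : n ≤ 2 * y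
  n≤2y = begin
    n                  ≤⟨ m+n≤o⇒m≤o∸n n (≤-trans (+-monoʳ-≤ n le) (≤-reflexive (cong (n +_) (sym (+-identityʳ n))))) ⟩
    2 * n ∸ 2 * s      ≡⟨ *-distribˡ-∸ 2 n s ⟨
    2 * y              ∎

-- (1 − x)ᵗ (1 + t x) ≤ 1 for x = z / (p + z)
p^t*[s+tz]≤s^t*s : ∀ p z t → p ^ t * (p + z + t * z) ≤ (p + z) ^ t * (p + z)
p^t*[s+tz]≤s^t*s p z zero = ≤-reflexive (cong (1 *_) (+-identityʳ (p + z)))
p^t*[s+tz]≤s^t*s p z (suc t) = begin
  p * p ^ t * (p + z + suc t * z)                                 ≤⟨ m≤m+n _ _ ⟩
  p * p ^ t * (p + z + suc t * z) + p ^ t * (z * z + t * (z * z)) ≡⟨ rearrange p z t (p ^ t) ⟩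
  (p + z) * (p ^ t * (p + z + t * z))                   ≤⟨ *-monoʳ-≤ (p + z) (p^t*[s+tz]≤s^t*s p z t) ⟩
  (p + z) * ((p + z) ^ t * (p + z))                     ≡⟨ *-assoc (p + z) _ _ ⟨
  (p + z) * (p + z) ^ t * (p + z)                       ∎
  where
  open ≤-Reasoning
  rearrange : ∀ p z t x → p * x * (p + z + suc t * z) + x * (z * z + t * (z * z)) ≡ (p + z) * (x * (p + z + t * z))
  rearrange = solve-∀

-- (1 − x)ᵗ ≤ 1 − t x / 2 for t x ≤ 1, by (1 + y) (1 − y / 2) ≥ 1.
2s*p^t+tz*s^t≤2s*s^t : ∀ p z t → 0 < p + z → t * z ≤ p + z →
  2 * (p + z) * p ^ t + t * z * (p + z) ^ t ≤ 2 * (p + z) * (p + z) ^ t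
2s*p^t+tz*s^t≤2s*s^t p z t 0<s y≤s = *-cancelʳ-≤ _ _ s {{>-nonZero 0<s}} (begin
  (2 * s * x + y * w) * s                   ≡⟨ cong (λ s → (2 * s * x + y * w) * s) u+y≡s ⟨
  (2 * (u + y) * x + y * w) * (u + y)       ≤⟨ m≤m+n _ (x * (y * u)) ⟩
  (2 * (u + y) * x + y * w) * (u + y) + x * (y * u)
    ≡⟨ rearrange u y x w ⟩
  x * (u + y + y) * (2 * u + y) + y * (w * (u + y))
    ≡⟨ cong (λ s → x * (s + y) * (2 * u + y) + y * (w * s)) u+y≡s ⟩
  x * (s + y) * (2 * u + y) + y * (w * s)
    ≤⟨ +-monoˡ-≤ _ (*-monoˡ-≤ (2 * u + y) main) ⟩
  w * s * (2 * u + y) + y * (w * s)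
    ≡⟨ rearrange′ u y w s ⟩
  2 * (u + y) * w * s
    ≡⟨ cong (λ e → 2 * e * w * s) u+y≡s ⟩
  2 * s * w * s ∎)
  where
  open ≤-Reasoning
  s = p + z
  x = p ^ t
  w = s ^ t
  y = t * z
  u = s ∸ y
  u+y≡s : u + y ≡ s
  u+y≡s = m∸n+n≡m y≤s
  main : x * (s + y) ≤ w * s
  main = p^t*[s+tz]≤s^t*s p z t
  rearrange : ∀ u y x w → (2 * (u + y) * x + y * w) * (u + y) + x * (y * u)
    ≡ x * (u + y + y) * (2 * u + y) + y * (w * (u + y))
  rearrange = solve-∀
  rearrange′ : ∀ u y w s → w * s * (2 * u + y) + y * (w * s) ≡ 2 * (u + y) * w * s
  rearrange′ = solve-∀

-- Since e ≥ 8 j, (1 - 1/2n)^e ≤ (1 - 1/n)^(2j). One factor (1 - 1/n)^j cancels the one on the left,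
-- which is the price of Markov's inequality; the other is at most 2^(-q) because j ≥ n q.
moment-tail : ∀ {n} → 2 ≤ n → ∀ q j e {b N} → n * q ≤ j → 8 * j ≤ e →
  b * ((n ∸ 1) ^ j * (2 * n) ^ e) ≤ n ^ j * ((2 * n ∸ 1) ^ e * N) → b * 2 ^ q ≤ N
moment-tail {n@(suc (suc k))} 2≤n@(s≤s (s≤s z≤n)) q j e {b} {N} nq≤j 8j≤e le =
  *-cancelʳ-≤ _ _ (n ^ j) {{m^n≢0 n j}} (begin
    b * 2 ^ q * n ^ j             ≡⟨ rearrange b (2 ^ q) (n ^ j) ⟩
    b * n ^ j * 2 ^ q             ≤⟨ *-monoˡ-≤ (2 ^ q) main ⟩
    N * (n ∸ 1) ^ j * 2 ^ q       ≡⟨ *-assoc N _ _ ⟩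
    N * ((n ∸ 1) ^ j * 2 ^ q)     ≤⟨ *-monoʳ-≤ N ([n∸1]^j*2^q≤n^j n q nq≤j) ⟩
    N * n ^ j                     ∎)
  where
  open ≤-Reasoning
  rearrange : ∀ a b c → a * b * c ≡ a * c * b
  rearrange = solve-∀
  x = (n ∸ 1) ^ j
  y = n ^ j
  w = (2 * n) ^ e
  v = (2 * n ∸ 1) ^ e
  instance
    x≢0 : NonZero x
    x≢0 = m^n≢0 (n ∸ 1) j
    y≢0 : NonZero y
    y≢0 = m^n≢0 n j
    w≢0 : NonZero w
    w≢0 = m^n≢0 (2 * n) e
  square : ∀ a → a ^ (2 * j) ≡ a ^ j * a ^ j
  square a = trans (cong (λ i → a ^ (j + i)) (+-identityʳ j)) (^-distribˡ-+-* a j j)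
  decay : v * (y * y) ≤ w * (x * x)
  decay = subst₂ (λ r s → v * r ≤ w * s) (square n) (square (n ∸ 1))
    ([2n∸1]^e*n^k≤[2n]^e*[n∸1]^k 2≤n (2 * j) (≤-trans (≤-reflexive (sym (*-assoc 4 2 j))) 8j≤e))
  rearrange₁ : ∀ b x y w → b * y * (x * w * y) ≡ b * (x * w) * (y * y)
  rearrange₁ = solve-∀
  rearrange₂ : ∀ y v N → y * (v * N) * (y * y) ≡ y * N * (v * (y * y))
  rearrange₂ = solve-∀
  rearrange₃ : ∀ x y w N → y * N * (w * (x * x)) ≡ N * x * (x * w * y)
  rearrange₃ = solve-∀
  main : b * y ≤ N * x
  main = *-cancelʳ-≤ _ _ (x * w * y) {{m*n≢0 (x * w) y {{m*n≢0 x w}}}} (begin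
    b * y * (x * w * y)         ≡⟨ rearrange₁ b x y w ⟩
    b * (x * w) * (y * y)       ≤⟨ *-monoˡ-≤ (y * y) le ⟩
    y * (v * N) * (y * y)       ≡⟨ rearrange₂ y v N ⟩
    y * N * (v * (y * y))       ≤⟨ *-monoʳ-≤ (y * N) decay ⟩
    y * N * (w * (x * x))       ≡⟨ rearrange₃ x y w N ⟩
    N * x * (x * w * y)         ∎)

-- If (1 − 1/n)ᵐ ≤ (θ/n)ᴰᴮ ≤ Q⁻ᴰᴮ and D M ≥ 4 m, then (1 − 1/2n)ᴹ ≤ Q⁻ᴮ.
small-target-decay : ∀ {n} → 2 ≤ n → ∀ Q D B m M θ .{{_ : NonZero D}} .{{_ : NonZero θ}} →
  4 * m ≤ M * D → θ * Q ≤ n →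
  n ^ (D * B) * (n ∸ 1) ^ m ≤ θ ^ (D * B) * n ^ m →
  (2 * n ∸ 1) ^ M * Q ^ B ≤ (2 * n) ^ M
small-target-decay {n@(suc (suc k))} 2≤n@(s≤s (s≤s z≤n)) Q D B m M θ 4m≤MD θQ≤n le =
  ^-cancelʳ-≤ D (*-cancelʳ-≤ _ _ (n ^ m) {{m^n≢0 n m}} (begin
    (v * Q ^ B) ^ D * n ^ m                      ≡⟨ cong (_* n ^ m) (^-distribʳ-* D v (Q ^ B)) ⟩
    v ^ D * (Q ^ B) ^ D * n ^ m                  ≡⟨ rearrange (v ^ D) ((Q ^ B) ^ D) (n ^ m) ⟩
    v ^ D * n ^ m * (Q ^ B) ^ D                  ≤⟨ *-monoˡ-≤ ((Q ^ B) ^ D) decay ⟩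
    w ^ D * (n ∸ 1) ^ m * (Q ^ B) ^ D            ≡⟨ cong (w ^ D * (n ∸ 1) ^ m *_) (trans (^-*-assoc Q B D) (cong (Q ^_) (*-comm B D))) ⟩
    w ^ D * (n ∸ 1) ^ m * Q ^ (D * B)            ≡⟨ *-assoc (w ^ D) _ _ ⟩
    w ^ D * ((n ∸ 1) ^ m * Q ^ (D * B))          ≤⟨ *-monoʳ-≤ (w ^ D) main ⟩
    w ^ D * n ^ m                                ∎))
  where
  open ≤-Reasoning
  v = (2 * n ∸ 1) ^ M
  w = (2 * n) ^ M
  E = D * B
  rearrange : ∀ a b c → a * b * c ≡ a * c * b
  rearrange = solve-∀
  decay : v ^ D * n ^ m ≤ w ^ D * (n ∸ 1) ^ m
  decay = subst₂ (λ a b → a * n ^ m ≤ b * (n ∸ 1) ^ m) (sym (^-*-assoc (2 * n ∸ 1) M D)) (sym (^-*-assoc (2 * n) M D))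
    ([2n∸1]^e*n^k≤[2n]^e*[n∸1]^k 2≤n m 4m≤MD)
  rearrange′ : ∀ a b c → a * b * c ≡ c * b * a
  rearrange′ = solve-∀
  main : (n ∸ 1) ^ m * Q ^ E ≤ n ^ m
  main = *-cancelʳ-≤ _ _ (θ ^ E) {{m^n≢0 θ E}} (begin
    (n ∸ 1) ^ m * Q ^ E * θ ^ E      ≡⟨ rearrange′ ((n ∸ 1) ^ m) (Q ^ E) (θ ^ E) ⟩
    θ ^ E * Q ^ E * (n ∸ 1) ^ m      ≡⟨ cong (_* (n ∸ 1) ^ m) (^-distribʳ-* E θ Q) ⟨
    (θ * Q) ^ E * (n ∸ 1) ^ m        ≤⟨ *-monoˡ-≤ _ (^-monoˡ-≤ E θQ≤n) ⟩
    n ^ E * (n ∸ 1) ^ m              ≤⟨ le ⟩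
    θ ^ E * n ^ m                    ≡⟨ *-comm (θ ^ E) (n ^ m) ⟩
    n ^ m * θ ^ E                    ∎)

q<2^q : ∀ q → q < 2 ^ q
q<2^q zero    = s≤s z≤n
q<2^q (suc q) = begin-strict
  suc q              ≤⟨ q<2^q q ⟩
  2 ^ q              <⟨ m<m+n (2 ^ q) (m^n>0 2 q) ⟩
  2 ^ q + 2 ^ q      ≡⟨ cong (2 ^ q +_) (+-identityʳ (2 ^ q)) ⟨
  2 * 2 ^ q          ∎
  where open ≤-Reasoning

-- The threshold 2 a + 5 = 1 + 2 (a + 2) lets the base case follow from squaring a + 3 ≤ 2^(a+2);
-- afterwards the right side doubles while the left side at most doubles.
a*[1+q]<2^q : ∀ a {q} → 2 * a + 5 ≤′ q → a * suc q < 2 ^ q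
a*[1+q]<2^q a ≤′-refl = begin-strict
  a * suc (2 * a + 5)                       <⟨ m<m+n _ {6 * a + 18} (subst (0 <_) (+-comm 18 (6 * a)) z<s) ⟩
  a * suc (2 * a + 5) + (6 * a + 18)        ≡⟨ expand a ⟩
  2 * (suc (a + 2) * suc (a + 2))           ≤⟨ *-monoʳ-≤ 2 (*-mono-≤ (q<2^q (a + 2)) (q<2^q (a + 2))) ⟩
  2 * (2 ^ (a + 2) * 2 ^ (a + 2))           ≡⟨ cong (2 *_) (^-distribˡ-+-* 2 (a + 2) (a + 2)) ⟨
  2 ^ suc (a + 2 + (a + 2))                 ≡⟨ cong (2 ^_) (double a) ⟩
  2 ^ (2 * a + 5)                           ∎
  where
  open ≤-Reasoning
  expand : ∀ a → a * suc (2 * a + 5) + (6 * a + 18) ≡ 2 * (suc (a + 2) * suc (a + 2))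
  expand = solve-∀
  double : ∀ a → suc (a + 2 + (a + 2)) ≡ 2 * a + 5
  double = solve-∀
a*[1+q]<2^q a {suc q} (≤′-step le) = begin-strict
  a * suc (suc q)        ≤⟨ m≤m+n _ (a * q) ⟩
  a * suc (suc q) + a * q ≡⟨ double a q ⟩
  2 * (a * suc q)        <⟨ *-monoʳ-< 2 (a*[1+q]<2^q a le) ⟩
  2 * 2 ^ q              ∎
  where
  open ≤-Reasoning
  double : ∀ a q → a * suc (suc q) + a * q ≡ 2 * (a * suc q)
  double = solve-∀

-- Redrawing one coordinate of a uniform tuple keeps it uniform: every tuple arises from `length xs`
-- pairs (v, a). So a position i may be chosen according to the keys, and the row there averaged
-- while all other rows stay fixed.
∑-resample : {A : Set} (xs : List A) (k : ℕ) (i : Fin k) (f : Vec A k → ℕ) →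
  (∑[ v ∈ vecs xs k ] ∑[ a ∈ xs ] f (v [ i ]≔ a)) ≡ length xs * ∑ (vecs xs k) f
∑-resample xs (suc k) zero f = begin
  _                                                               ≡⟨ ∑-vecs-suc xs k _ ⟩
  (∑[ _ ∈ xs ] ∑[ v ∈ vecs xs k ] ∑[ a ∈ xs ] f (a ∷ v))          ≡⟨ ∑-const xs _ ⟩
  length xs * (∑[ v ∈ vecs xs k ] ∑[ a ∈ xs ] f (a ∷ v))          ≡⟨ cong (length xs *_) (∑-swap (vecs xs k) xs _) ⟩
  length xs * (∑[ a ∈ xs ] ∑[ v ∈ vecs xs k ] f (a ∷ v))          ≡⟨ cong (length xs *_) (∑-vecs-suc xs k f) ⟨
  length xs * ∑ (vecs xs (suc k)) f                               ∎
  where open ≡-Reasoning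
∑-resample xs (suc k) (suc i) f = begin
  _                                                                     ≡⟨ ∑-vecs-suc xs k _ ⟩
  (∑[ b ∈ xs ] ∑[ v ∈ vecs xs k ] ∑[ a ∈ xs ] f (b ∷ (v [ i ]≔ a)))     ≡⟨ ∑-cong xs (λ b → ∑-resample xs k i (f ∘ (b ∷_))) ⟩
  (∑[ b ∈ xs ] (length xs * (∑[ v ∈ vecs xs k ] f (b ∷ v))))            ≡⟨ *-distribˡ-∑ (length xs) xs _ ⟩
  length xs * (∑[ b ∈ xs ] ∑[ v ∈ vecs xs k ] f (b ∷ v))                ≡⟨ cong (length xs *_) (∑-vecs-suc xs k f) ⟨
  length xs * ∑ (vecs xs (suc k)) f                                     ∎
  where open ≡-Reasoning

-- Either every `h i` is positive, and then so is the product, or some `l i` is. It will charge a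
-- key either to having heavy characters everywhere or to a position where its character is light.
1≤∏+∑ : ∀ k (h l : Fin k → ℕ) → (∀ i → 1 ≤ h i + l i) → 1 ≤ ∏ k h + ∑ (allFin k) l
1≤∏+∑ zero    h l e = ≤-refl
1≤∏+∑ (suc k) h l e = subst (λ s → 1 ≤ h zero * ∏ k (h ∘ suc) + s) (sym (∑-allFin-suc k l)) (go (h zero) (l zero) (e zero))
  where
  p = ∏ k (h ∘ suc)
  s = ∑ (allFin k) (l ∘ suc)
  go : ∀ a b → 1 ≤ a + b → 1 ≤ a * p + (b + s)
  go zero    (suc b) _ = s≤s z≤n
  go (suc a) b       _ = ≤-trans (1≤∏+∑ k (h ∘ suc) (l ∘ suc) (e ∘ suc))
    (+-mono-≤ (m≤m+n p (a * p)) (m≤n+m s b))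

∏*^≤^ : ∀ k (f : Fin k → ℕ) {τ m} → (∀ i → f i * τ ≤ m) → ∏ k f * τ ^ k ≤ m ^ k
∏*^≤^ zero    f e = ≤-refl
∏*^≤^ (suc k) f {τ} {m} e = ≤-trans (≤-reflexive (rearrange (f zero) (∏ k (f ∘ suc)) τ (τ ^ k)))
  (*-mono-≤ (e zero) (∏*^≤^ k (f ∘ suc) (e ∘ suc)))
  where
  rearrange : ∀ a b c d → a * b * (c * d) ≡ a * c * (b * d)
  rearrange = solve-∀

∏≡1 : ∀ k {f : Fin k → ℕ} → (∀ i → f i ≡ 1) → ∏ k f ≡ 1
∏≡1 zero    e = refl
∏≡1 (suc k) e = cong₂ _*_ (e zero) (∏≡1 k (e ∘ suc))

∃-∑≤k*f : ∀ k .{{_ : NonZero k}} (f : Fin k → ℕ) → ∃[ i ] ∑ (allFin k) f ≤ k * f i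
∃-∑≤k*f 1 f = zero , ≤-refl
∃-∑≤k*f (suc k@(suc _)) f with ∃-∑≤k*f k (f ∘ suc)
... | i , le with f zero ≤? f (suc i)
...   | yes f₀≤fᵢ = suc i , ≤-trans (≤-reflexive (∑-allFin-suc k f)) (+-mono-≤ f₀≤fᵢ le)
...   | no  f₀≰fᵢ = zero , ≤-trans (≤-reflexive (∑-allFin-suc k f))
  (+-monoʳ-≤ (f zero) (≤-trans le (*-monoʳ-≤ k (≰⇒≥ f₀≰fᵢ))))

-- Tabulation hashing over an elementary abelian 2-group

module Hashing
  (n : ℕ) .{{n≢0 : NonZero n}}
  (_⊕_ : Fin n → Fin n → Fin n) (0# : Fin n)
  (⊕-assoc : ∀ x y z → (x ⊕ y) ⊕ z ≡ x ⊕ (y ⊕ z))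
  (⊕-comm : ∀ x y → x ⊕ y ≡ y ⊕ x)
  (⊕-identityˡ : ∀ x → 0# ⊕ x ≡ x)
  (⊕-self : ∀ x → x ⊕ x ≡ 0#)
  (σ : ℕ)
  where

  bins : List (Fin n)
  bins = allFin n

  chars : List (Fin σ)
  chars = allFin σ

  Key Tables : ℕ → Set
  Key c = Vec (Fin σ) c
  Tables c = Vec (Vec (Fin n) σ) c

  keys : (c : ℕ) → List (Key c)
  keys = vecs chars

  rows : List (Vec (Fin n) σ)
  rows = vecs bins σ

  tabs : (c : ℕ) → List (Tables c)
  tabs = vecs rows

  N : ℕ
  N = n ^ σ

  length-rows : length rows ≡ N
  length-rows = trans (length-vecs bins σ) (cong (_^ σ) (length-allFin n))

  length-tabs : (c : ℕ) → length (tabs c) ≡ N ^ c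
  length-tabs c = trans (length-vecs rows c) (cong (_^ c) length-rows)

  H : ∀ {c} → Tables c → Key c → Fin n
  H []       []       = 0#
  H (t ∷ ts) (a ∷ x) = lookup t a ⊕ H ts x

  ⊕-cancelʳ : ∀ x y → (x ⊕ y) ⊕ y ≡ x
  ⊕-cancelʳ x y = begin
    (x ⊕ y) ⊕ y  ≡⟨ ⊕-assoc x y y ⟩
    x ⊕ (y ⊕ y)  ≡⟨ cong (x ⊕_) (⊕-self y) ⟩
    x ⊕ 0#       ≡⟨ ⊕-comm x 0# ⟩
    0# ⊕ x       ≡⟨ ⊕-identityˡ x ⟩
    x            ∎
    where open ≡-Reasoning

  δ-⊕ : ∀ a b y → δ (a ⊕ b) y ≡ δ b (y ⊕ a)
  δ-⊕ a b y = 𝟙-cong ((a ⊕ b) Fin.≟ y) (b Fin.≟ (y ⊕ a))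
    (λ e → trans (sym (⊕-cancelʳ b a)) (cong (_⊕ a) (trans (⊕-comm b a) e)))
    (λ e → trans (⊕-comm a b) (trans (cong (_⊕ a) e) (⊕-cancelʳ y a)))

  ∑-shift : (s : Fin n) (f : Fin n → ℕ) → (∑[ y ∈ bins ] f (y ⊕ s)) ≡ ∑ bins f
  ∑-shift s f = begin
    (∑[ y ∈ bins ] f (y ⊕ s))                               ≡⟨ ∑-cong bins (λ y → sym (∑-δ (y ⊕ s) f)) ⟩
    (∑[ y ∈ bins ] ∑[ z ∈ bins ] (δ (y ⊕ s) z * f z))       ≡⟨ ∑-swap bins bins _ ⟩
    (∑[ z ∈ bins ] ∑[ y ∈ bins ] (δ (y ⊕ s) z * f z))       ≡⟨ ∑-cong bins (λ z → *-distribʳ-∑ (f z) bins _) ⟩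
    (∑[ z ∈ bins ] ((∑[ y ∈ bins ] δ (y ⊕ s) z) * f z))     ≡⟨ ∑-cong bins (λ z → cong (_* f z) (one z)) ⟩
    (∑[ z ∈ bins ] (1 * f z))                               ≡⟨ ∑-cong bins (λ z → *-identityˡ (f z)) ⟩
    ∑ bins f                                                ∎
    where
    open ≡-Reasoning
    one : ∀ z → (∑[ y ∈ bins ] δ (y ⊕ s) z) ≡ 1
    one z = trans (∑-cong bins λ y → 𝟙-cong (y ⊕ s Fin.≟ z) (z ⊕ s Fin.≟ y)
        (λ e → trans (cong (_⊕ s) (sym e)) (⊕-cancelʳ y s))
        (λ e → trans (cong (_⊕ s) (sym e)) (⊕-cancelʳ z s)))
      (∑-δ-1 (z ⊕ s))

  ∑-shiftˡ : (y : Fin n) (f : Fin n → ℕ) → (∑[ s ∈ bins ] f (y ⊕ s)) ≡ ∑ bins f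
  ∑-shiftˡ y f = trans (∑-cong bins λ s → cong f (⊕-comm y s)) (∑-shift y f)

  -- A set of keys enters as a weight with values at most 1: fixing the first character is then
  -- composition with `a ∷_`, and selecting keys is multiplication by an indicator.
  load : ∀ {c} → Tables c → (Key c → ℕ) → Fin n → ℕ
  load {c} ts w y = ∑[ x ∈ keys c ] (w x * δ (H ts x) y)

  -- All keys starting with a receive the same summand `lookup t a`, so their load under `ts` is
  -- translated as a whole. `δ-⊕` moves the translation to the bin, each element being its own
  -- inverse.
  load-cons : ∀ {c} t (ts : Tables c) w y →
    load (t ∷ ts) w y ≡ (∑[ a ∈ chars ] load ts (w ∘ (a ∷_)) (y ⊕ lookup t a))
  load-cons {c} t ts w y = trans (∑-vecs-suc chars c _)
    (∑-cong chars λ a → ∑-cong (keys c) λ x → cong (w (a ∷ x) *_) (δ-⊕ (lookup t a) (H ts x) y))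

  ∑-load : ∀ {c} (ts : Tables c) w → ∑ bins (load ts w) ≡ ∑ (keys c) w
  ∑-load {c} ts w = trans (∑-swap bins (keys c) _) (∑-cong (keys c) λ x →
    trans (*-distribˡ-∑ (w x) bins _) (trans (cong (w x *_) (∑-δ-1 (H ts x))) (*-identityʳ (w x))))

  load≤∑ : ∀ {c} (ts : Tables c) w y → load ts w y ≤ ∑ (keys c) w
  load≤∑ {c} ts w y = ∑-mono (keys c) λ x → ≤-trans (*-monoʳ-≤ (w x) (𝟙≤1 (H ts x Fin.≟ y))) (≤-reflexive (*-identityʳ (w x)))

  Overloaded : ∀ {c} → ℕ → Tables c → (Key c → ℕ) → Set
  Overloaded d ts w = ∃[ y ] d < load ts w y

  overloaded? : ∀ {c} d (ts : Tables c) w → Dec (Overloaded d ts w)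
  overloaded? d ts w = Fin.any? λ y → d <? load ts w y

  -- Maximum load of small sets

  module _ (Q T : ℕ) .{{_ : NonZero Q}} where

    hits : ∀ {c} → Vec (Fin n) σ → Tables c → (Key (suc c) → ℕ) → Fin n → ℕ
    hits t ts w y = ∑[ a ∈ chars ] (1 ⊓ load ts (w ∘ (a ∷_)) (y ⊕ lookup t a))

    load≤D*hits : ∀ {c} {D} t (ts : Tables c) w → (∀ a z → load ts (w ∘ (a ∷_)) z ≤ D) → ∀ y →
      load (t ∷ ts) w y ≤ D * hits t ts w y
    load≤D*hits {D = D} t ts w le y = begin
      load (t ∷ ts) w y                                          ≡⟨ load-cons t ts w y ⟩
      (∑[ a ∈ chars ] load ts (w ∘ (a ∷_)) (y ⊕ lookup t a))     ≤⟨ ∑-mono chars (λ a → l≤d*[1⊓l] (le a _)) ⟩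
      (∑[ a ∈ chars ] (D * (1 ⊓ load ts (w ∘ (a ∷_)) (y ⊕ lookup t a)))) ≡⟨ *-distribˡ-∑ D chars _ ⟩
      D * hits t ts w y                                          ∎
      where open ≤-Reasoning

    -- If no group has more than D keys in any bin, a load above T · D at y needs more than T groups
    -- reaching y. The two sums are the union bounds over the groups and over the bins.
    overloaded-cons : ∀ {c} D t (ts : Tables c) w →
      𝟙 (overloaded? (T * D) (t ∷ ts) w) ≤
      (∑[ a ∈ chars ] 𝟙 (overloaded? D ts (w ∘ (a ∷_)))) + (∑[ y ∈ bins ] 𝟙 (T ≤? hits t ts w y))
    overloaded-cons D t ts w = 𝟙-≤ (overloaded? (T * D) (t ∷ ts) w) λ (y , over) → cases y over
      where
      open ≤-Reasoning
      cases : ∀ y → T * D < load (t ∷ ts) w y → 1 ≤ _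
      cases y over with Fin.any? (λ a → overloaded? D ts (w ∘ (a ∷_)))
      ... | yes (a , over-a) = begin
        1                                                    ≡⟨ 𝟙-yes (overloaded? D ts (w ∘ (a ∷_))) over-a ⟨
        𝟙 (overloaded? D ts (w ∘ (a ∷_)))                    ≤⟨ ∈⇒≤∑ (λ a → 𝟙 (overloaded? D ts (w ∘ (a ∷_)))) (∈-allFin a) ⟩
        (∑[ a ∈ chars ] 𝟙 (overloaded? D ts (w ∘ (a ∷_))))   ≤⟨ m≤m+n _ _ ⟩
        _                                                    ∎
      ... | no ¬over = begin
        1                                                    ≡⟨ 𝟙-yes (T ≤? hits t ts w y) T≤hits ⟨
        𝟙 (T ≤? hits t ts w y)                               ≤⟨ ∈⇒≤∑ (λ y → 𝟙 (T ≤? hits t ts w y)) (∈-allFin y) ⟩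
        (∑[ y ∈ bins ] 𝟙 (T ≤? hits t ts w y))               ≤⟨ m≤n+m _ _ ⟩
        _                                                    ∎
        where
        T≤hits : T ≤ hits t ts w y
        T≤hits = <⇒≤ (*-cancelˡ-< D T (hits t ts w y) (begin-strict
          D * T               ≡⟨ *-comm D T ⟩
          T * D               <⟨ over ⟩
          load (t ∷ ts) w y   ≤⟨ load≤D*hits t ts w (λ a z → ≮⇒≥ λ lt → ¬over (a , z , lt)) y ⟩
          D * hits t ts w y   ∎))

    -- The shifts of distinct characters are independent, so E[Q^hits] is a product.
    ∑-hits : ∀ {c} (ts : Tables c) w → 2 * (Q * ∑ (keys (suc c)) w) ≤ n → ∀ y →
      (∑[ t ∈ rows ] 𝟙 (T ≤? hits t ts w y)) * Q ^ T ≤ 2 * N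
    ∑-hits {c} ts w small y = begin
      (∑[ t ∈ rows ] 𝟙 (T ≤? hits t ts w y)) * Q ^ T      ≡⟨ *-distribʳ-∑ (Q ^ T) rows _ ⟨
      (∑[ t ∈ rows ] (𝟙 (T ≤? hits t ts w y) * Q ^ T))    ≤⟨ ∑-mono rows (λ t → 𝟙*-≤ (T ≤? hits t ts w y) (^-monoʳ-≤ Q)) ⟩
      (∑[ t ∈ rows ] (Q ^ hits t ts w y))                 ≡⟨ ∑-cong rows (λ t → ^-∑ Q σ _) ⟩
      (∑[ t ∈ rows ] ∏ σ (λ a → Q ^ (1 ⊓ L a (y ⊕ lookup t a)))) ≡⟨ ∑-vecs-∏ bins σ (λ a s → Q ^ (1 ⊓ L a (y ⊕ s))) ⟩
      ∏ σ (λ a → ∑[ s ∈ bins ] (Q ^ (1 ⊓ L a (y ⊕ s))))   ≡⟨ ∏-cong σ (λ a → ∑-shiftˡ y (λ z → Q ^ (1 ⊓ L a z))) ⟩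
      -- Group a occupies at most `S a` bins, so at most that many of its n shifts reach y and
      -- contribute Q instead of 1. `small` keeps the sum of the excesses at most n/2, hence the
      -- factor 2.
      ∏ σ (λ a → ∑[ z ∈ bins ] (Q ^ (1 ⊓ L a z)))         ≤⟨ ∏-mono σ factor ⟩
      ∏ σ (λ a → n + Q * S a)                             ≤⟨ ∏[n+x]≤2*n^k n σ (λ a → Q * S a) small′ ⟩
      2 * N                                               ∎
      where
      open ≤-Reasoning
      L : Fin σ → Fin n → ℕ
      L a = load ts (w ∘ (a ∷_))
      S : Fin σ → ℕ
      S a = ∑ (keys c) (w ∘ (a ∷_))
      pow : ∀ l → Q ^ (1 ⊓ l) ≤ 1 + Q * l
      pow zero    = s≤s z≤n
      pow (suc l) = ≤-trans (*-monoʳ-≤ Q (s≤s z≤n)) (n≤1+n _)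
      factor : ∀ a → (∑[ z ∈ bins ] (Q ^ (1 ⊓ L a z))) ≤ n + Q * S a
      factor a = begin
        (∑[ z ∈ bins ] (Q ^ (1 ⊓ L a z)))                 ≤⟨ ∑-mono bins (λ z → pow (L a z)) ⟩
        (∑[ z ∈ bins ] (1 + Q * L a z))                   ≡⟨ ∑-distrib-+ bins _ _ ⟩
        (∑[ z ∈ bins ] 1) + (∑[ z ∈ bins ] (Q * L a z))   ≡⟨ cong₂ _+_ (trans (∑-allFin-const n 1) (*-identityʳ n))
                                                               (trans (*-distribˡ-∑ Q bins (L a)) (cong (Q *_) (∑-load ts _))) ⟩
        n + Q * S a                                       ∎
      small′ : 2 * (∑[ a ∈ allFin σ ] (Q * S a)) ≤ n
      small′ = subst (λ e → 2 * e ≤ n)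
        (trans (cong (Q *_) (∑-vecs-suc chars c w)) (sym (*-distribˡ-∑ Q chars S))) small

    -- Each further character multiplies the permitted load by T and adds n bins with failure
    -- probability 2/Q^T. The bound is kept proportional to the number of keys so that the bounds
    -- for the groups add up to one for the whole set, whatever σ is.
    overload-bound : (c : ℕ) (w : Key c → ℕ) → (∀ x → w x ≤ 1) → 2 * (Q * ∑ (keys c) w) ≤ n →
      (∑[ ts ∈ tabs c ] 𝟙 (overloaded? (T ^ c) ts w)) * Q ^ T ≤ 2 * c * n * ∑ (keys c) w * N ^ c
    overload-bound zero w w≤1 small = ≤-reflexive (cong (_* Q ^ T) (cong (_+ 0) (𝟙-no (overloaded? 1 [] w) not)))
      where
      not : ¬ Overloaded 1 [] w
      not (y , lt) = <⇒≱ lt (≤-trans (load≤∑ [] w y) (≤-trans (≤-reflexive (+-identityʳ _)) (w≤1 [])))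
    overload-bound (suc c) w w≤1 small with ∑ (keys (suc c)) w in eq
    -- For a set without keys the bound is 0 and overload must be impossible. With at least one key,
    -- the contribution of `hits`, which does not scale with the set, may be multiplied by m.
    ... | zero = subst (λ s → s * Q ^ T ≤ _) (sym (∑-zero (tabs (suc c)) λ ts → 𝟙-no (overloaded? (T * T ^ c) ts w) (not ts))) z≤n
      where
      not : ∀ ts → ¬ Overloaded (T * T ^ c) ts w
      not ts (y , lt) = <⇒≱ lt (≤-trans (load≤∑ ts w y) (≤-trans (≤-reflexive eq) z≤n))
    ... | m@(suc _) = begin
      (∑[ ts ∈ tabs (suc c) ] 𝟙 (overloaded? (T ^ suc c) ts w)) * Q ^ T
        ≡⟨ cong (_* Q ^ T) (∑-vecs-suc rows c _) ⟩
      (∑[ t ∈ rows ] ∑[ ts ∈ tabs c ] 𝟙 (overloaded? (T * D) (t ∷ ts) w)) * Q ^ T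
        ≤⟨ *-monoˡ-≤ (Q ^ T) (∑-mono rows λ t → ∑-mono (tabs c) λ ts → overloaded-cons D t ts w) ⟩
      (∑[ t ∈ rows ] ∑[ ts ∈ tabs c ] (O ts + P t ts)) * Q ^ T
        ≡⟨ cong (_* Q ^ T) (trans (∑-cong rows λ t → ∑-distrib-+ (tabs c) O (P t)) (∑-distrib-+ rows _ _)) ⟩
      ((∑[ t ∈ rows ] ∑ (tabs c) O) + (∑[ t ∈ rows ] ∑[ ts ∈ tabs c ] P t ts)) * Q ^ T
        ≡⟨ *-distribʳ-+ (Q ^ T) (∑[ t ∈ rows ] ∑ (tabs c) O) _ ⟩
      (∑[ t ∈ rows ] ∑ (tabs c) O) * Q ^ T + (∑[ t ∈ rows ] ∑[ ts ∈ tabs c ] P t ts) * Q ^ T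
        ≤⟨ +-mono-≤ inner outer ⟩
      N * (2 * c * n * m * N ^ c) + N ^ c * (n * (2 * N))
        ≤⟨ +-monoʳ-≤ (N * (2 * c * n * m * N ^ c)) (m≤m*n (N ^ c * (n * (2 * N))) m) ⟩
      N * (2 * c * n * m * N ^ c) + N ^ c * (n * (2 * N)) * m
        ≡⟨ rearrange N c n m (N ^ c) ⟩
      2 * suc c * n * m * (N * N ^ c) ∎
      where
      open ≤-Reasoning
      D = T ^ c
      O : Tables c → ℕ
      O ts = ∑[ a ∈ chars ] 𝟙 (overloaded? D ts (w ∘ (a ∷_)))
      P : Vec (Fin n) σ → Tables c → ℕ
      P t ts = ∑[ y ∈ bins ] 𝟙 (T ≤? hits t ts w y)
      rearrange : ∀ N c n m x → N * (2 * c * n * m * x) + x * (n * (2 * N)) * m ≡ 2 * suc c * n * m * (N * x)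
      rearrange = solve-∀
      S : Fin σ → ℕ
      S a = ∑ (keys c) (w ∘ (a ∷_))
      ∑S≡m : ∑ chars S ≡ m
      ∑S≡m = trans (sym (∑-vecs-suc chars c w)) eq
      S≤m : ∀ a → S a ≤ m
      S≤m a = ≤-trans (∈⇒≤∑ S (∈-allFin a)) (≤-reflexive ∑S≡m)
      inner : (∑[ t ∈ rows ] ∑ (tabs c) O) * Q ^ T ≤ N * (2 * c * n * m * N ^ c)
      inner = begin
        (∑[ t ∈ rows ] ∑ (tabs c) O) * Q ^ T
          ≡⟨ cong (_* Q ^ T) (trans (∑-const rows _) (cong (_* ∑ (tabs c) O) length-rows)) ⟩
        N * ∑ (tabs c) O * Q ^ T
          ≡⟨ *-assoc N _ _ ⟩
        N * (∑ (tabs c) O * Q ^ T)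
          ≡⟨ cong (λ e → N * (e * Q ^ T)) (∑-swap (tabs c) chars _) ⟩
        N * ((∑[ a ∈ chars ] ∑[ ts ∈ tabs c ] 𝟙 (overloaded? D ts (w ∘ (a ∷_)))) * Q ^ T)
          ≡⟨ cong (N *_) (*-distribʳ-∑ (Q ^ T) chars _) ⟨
        N * (∑[ a ∈ chars ] ((∑[ ts ∈ tabs c ] 𝟙 (overloaded? D ts (w ∘ (a ∷_)))) * Q ^ T))
          ≤⟨ *-monoʳ-≤ N (∑-mono chars λ a → overload-bound c (w ∘ (a ∷_)) (w≤1 ∘ (a ∷_))
               (≤-trans (*-monoʳ-≤ 2 (*-monoʳ-≤ Q (S≤m a))) small)) ⟩
        N * (∑[ a ∈ chars ] (2 * c * n * S a * N ^ c))
          ≡⟨ cong (N *_) (trans (*-distribʳ-∑ (N ^ c) chars _) (cong (_* N ^ c) (*-distribˡ-∑ (2 * c * n) chars S))) ⟩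
        N * (2 * c * n * ∑ chars S * N ^ c)
          ≡⟨ cong (λ e → N * (2 * c * n * e * N ^ c)) ∑S≡m ⟩
        N * (2 * c * n * m * N ^ c) ∎
      small′ : 2 * (Q * ∑ (keys (suc c)) w) ≤ n
      small′ = subst (λ e → 2 * (Q * e) ≤ n) (sym eq) small
      outer : (∑[ t ∈ rows ] ∑[ ts ∈ tabs c ] P t ts) * Q ^ T ≤ N ^ c * (n * (2 * N))
      outer = begin
        (∑[ t ∈ rows ] ∑[ ts ∈ tabs c ] P t ts) * Q ^ T
          ≡⟨ cong (_* Q ^ T) (∑-swap rows (tabs c) P) ⟩
        (∑[ ts ∈ tabs c ] ∑[ t ∈ rows ] P t ts) * Q ^ T
          ≡⟨ cong (_* Q ^ T) (∑-cong (tabs c) λ ts → ∑-swap rows bins _) ⟩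
        (∑[ ts ∈ tabs c ] ∑[ y ∈ bins ] ∑[ t ∈ rows ] 𝟙 (T ≤? hits t ts w y)) * Q ^ T
          ≡⟨ *-distribʳ-∑ (Q ^ T) (tabs c) _ ⟨
        (∑[ ts ∈ tabs c ] ((∑[ y ∈ bins ] ∑[ t ∈ rows ] 𝟙 (T ≤? hits t ts w y)) * Q ^ T))
          ≡⟨ ∑-cong (tabs c) (λ ts → *-distribʳ-∑ (Q ^ T) bins _) ⟨
        (∑[ ts ∈ tabs c ] ∑[ y ∈ bins ] ((∑[ t ∈ rows ] 𝟙 (T ≤? hits t ts w y)) * Q ^ T))
          ≤⟨ ∑-mono (tabs c) (λ ts → ∑-mono bins λ y → ∑-hits ts w small′ y) ⟩
        (∑[ ts ∈ tabs c ] ∑[ y ∈ bins ] (2 * N))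
          ≡⟨ trans (∑-const (tabs c) _) (cong₂ _*_ (length-tabs c) (∑-allFin-const n (2 * N))) ⟩
        N ^ c * (n * (2 * N)) ∎

  -- Truncated moments of the number of uncovered bins

  φ : (t θ s : ℕ) → ℕ
  φ t θ s = 𝟙 (θ ≤? s) * s ^ t

  -- The weight u is constantly 1 in the applications. It is kept general so that the shifts can be
  -- revealed one by one, u becoming the indicator of the bins that are still uncovered.
  free : ∀ {k} → (Fin n → ℕ) → (Fin k → Fin n → ℕ) → Vec (Fin n) k → ℕ
  free {k} u l v = ∑[ y ∈ bins ] (u y * ∏ k (λ a → 1 ∸ l a (y ⊕ lookup v a)))

  -- The hypothesis `tz≤s` is abstract because two moments are needed: a large t with θ = t τ, where
  -- it follows from z ≤ τ, and t = θ = 1, where it is z ≤ s itself.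
  module _ (t θ τ : ℕ) .{{_ : NonZero θ}} (tz≤s : ∀ {z s} → z ≤ τ → z ≤ s → θ ≤ s → t * z ≤ s) where

    -- Truncating sᵗ at θ keeps the relative change of s in one step below 1/t.
    φ-step : (u l : Fin n → ℕ) → (∀ y → u y ≤ 1) → (∑[ z ∈ bins ] (1 ⊓ l z)) ≤ τ →
      (∑[ s ∈ bins ] φ t θ (∑[ y ∈ bins ] (u y * (1 ∸ l (y ⊕ s))))) * (2 * n) ^ (t * (∑[ z ∈ bins ] (1 ⊓ l z)))
      ≤ φ t θ (∑ bins u) * ((2 * n ∸ 1) ^ (t * (∑[ z ∈ bins ] (1 ⊓ l z))) * n)
    φ-step u l u≤1 b≤τ with θ ≤? ∑ bins u
    -- The number of uncovered bins never grows, so once it is below θ both sides are 0.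
    ... | no θ≰s = ≤-trans (≤-reflexive (cong (_* (2 * n) ^ (t * b)) (∑-zero bins λ v →
        cong (_* p v ^ t) (𝟙-no (θ ≤? p v) λ θ≤p → θ≰s (≤-trans θ≤p (p≤s v)))))) z≤n
      where
      b = ∑[ z ∈ bins ] (1 ⊓ l z)
      p : Fin n → ℕ
      p v = ∑[ y ∈ bins ] (u y * (1 ∸ l (y ⊕ v)))
      p≤s : ∀ v → p v ≤ ∑ bins u
      p≤s v = ∑-mono bins λ y → ≤-trans (*-monoʳ-≤ (u y) (m∸n≤m 1 (l (y ⊕ v)))) (≤-reflexive (*-identityʳ (u y)))
    ... | yes θ≤s = *-cancelˡ-≤ 2 (begin
        2 * ((∑[ v ∈ bins ] φ t θ (p v)) * w)            ≤⟨ *-monoʳ-≤ 2 (*-monoˡ-≤ w (∑-mono bins λ v → 𝟙*-≤ (θ ≤? p v) λ _ → ≤-refl)) ⟩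
        2 * ((∑[ v ∈ bins ] (p v ^ t)) * w)              ≡⟨ *-assoc 2 (∑[ v ∈ bins ] (p v ^ t)) w ⟨
        2 * (∑[ v ∈ bins ] (p v ^ t)) * w                ≤⟨ *-monoˡ-≤ w average ⟩
        (2 * n ∸ t * b) * x * w                          ≡⟨ rearrange₁ (2 * n ∸ t * b) x w ⟩
        -- Replacing 1 - tb/2n by (1 - 1/2n)^(tb) lets the factors of different groups multiply to
        -- one that depends only on the sum of the b.
        x * ((2 * n ∸ t * b) * w)                        ≤⟨ *-monoʳ-≤ x (bernoulli-∸ (2 * n) (t * b)) ⟩
        x * (2 * n * (2 * n ∸ 1) ^ (t * b))              ≡⟨ rearrange₂ x n ((2 * n ∸ 1) ^ (t * b)) ⟩
        2 * (1 * x * ((2 * n ∸ 1) ^ (t * b) * n))        ≡⟨ cong (λ e → 2 * (e * x * ((2 * n ∸ 1) ^ (t * b) * n))) (𝟙-yes (θ ≤? s) θ≤s) ⟨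
        2 * (φ t θ s * ((2 * n ∸ 1) ^ (t * b) * n))      ∎)
      where
      open ≤-Reasoning
      s = ∑ bins u
      b = ∑[ z ∈ bins ] (1 ⊓ l z)
      w = (2 * n) ^ (t * b)
      x = s ^ t
      p q : Fin n → ℕ
      p v = ∑[ y ∈ bins ] (u y * (1 ∸ l (y ⊕ v)))
      q v = ∑[ y ∈ bins ] (u y * (1 ⊓ l (y ⊕ v)))
      0<s : 0 < s
      0<s = ≤-trans (>-nonZero⁻¹ θ) θ≤s
      rearrange₁ : ∀ a b c → a * b * c ≡ b * (a * c)
      rearrange₁ = solve-∀
      rearrange₂ : ∀ x n c → x * (2 * n * c) ≡ 2 * (1 * x * (c * n))
      rearrange₂ = solve-∀
      p+q≡s : ∀ v → p v + q v ≡ s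
      p+q≡s v = trans (sym (∑-distrib-+ bins _ _)) (∑-cong bins λ y →
        trans (sym (*-distribˡ-+ (u y) (1 ∸ l (y ⊕ v)) (1 ⊓ l (y ⊕ v))))
          (trans (cong (u y *_) (trans (+-comm (1 ∸ l (y ⊕ v)) _) (1⊓k+[1∸k]≡1 (l (y ⊕ v))))) (*-identityʳ (u y))))
      q≤b : ∀ v → q v ≤ b
      q≤b v = ≤-trans (∑-mono bins λ y → ≤-trans (*-monoˡ-≤ _ (u≤1 y)) (≤-reflexive (*-identityˡ _)))
        (≤-reflexive (∑-shift v λ z → 1 ⊓ l z))
      pointwise : ∀ v → 2 * s * p v ^ t + t * x * q v ≤ 2 * s * x
      pointwise v = subst (_≤ 2 * s * x) (cong (2 * s * p v ^ t +_) (rearrange₃ t (q v) x))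
        (subst (λ s → 2 * s * p v ^ t + t * q v * s ^ t ≤ 2 * s * s ^ t) (p+q≡s v)
          (2s*p^t+tz*s^t≤2s*s^t (p v) (q v) t (subst (0 <_) (sym (p+q≡s v)) 0<s)
            (subst (t * q v ≤_) (sym (p+q≡s v))
              (tz≤s (≤-trans (q≤b v) b≤τ) (subst (q v ≤_) (p+q≡s v) (m≤n+m (q v) (p v))) θ≤s))))
        where
        rearrange₃ : ∀ t z x → t * z * x ≡ t * x * z
        rearrange₃ = solve-∀
      -- Double counting: each of the s uncovered bins is covered by exactly b of the n shifts.
      ∑q≡s*b : ∑ bins q ≡ s * b
      ∑q≡s*b = trans (∑-swap bins bins _) (trans (∑-cong bins λ y →
        trans (*-distribˡ-∑ (u y) bins _) (cong (u y *_) (∑-shiftˡ y λ z → 1 ⊓ l z))) (*-distribʳ-∑ b bins u))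
      summed : 2 * s * (∑[ v ∈ bins ] (p v ^ t)) + t * x * (s * b) ≤ n * (2 * s * x)
      summed = begin
        2 * s * (∑[ v ∈ bins ] (p v ^ t)) + t * x * (s * b)
          ≡⟨ cong₂ _+_ (*-distribˡ-∑ (2 * s) bins _) (trans (*-distribˡ-∑ (t * x) bins q) (cong (t * x *_) ∑q≡s*b)) ⟨
        (∑[ v ∈ bins ] (2 * s * p v ^ t)) + (∑[ v ∈ bins ] (t * x * q v))  ≡⟨ ∑-distrib-+ bins _ _ ⟨
        (∑[ v ∈ bins ] (2 * s * p v ^ t + t * x * q v))                    ≤⟨ ∑-mono bins pointwise ⟩
        (∑[ v ∈ bins ] (2 * s * x))                                        ≡⟨ ∑-allFin-const n _ ⟩
        n * (2 * s * x)                                                    ∎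
      average : 2 * (∑[ v ∈ bins ] (p v ^ t)) ≤ (2 * n ∸ t * b) * x
      average = subst (2 * (∑[ v ∈ bins ] (p v ^ t)) ≤_) (sym (*-distribʳ-∸ x (2 * n) (t * b)))
        (m+n≤o⇒m≤o∸n (2 * (∑[ v ∈ bins ] (p v ^ t))) (*-cancelʳ-≤ _ _ s {{>-nonZero 0<s}}
          (subst₂ _≤_ (rearrange₄ s (∑[ v ∈ bins ] (p v ^ t)) t x b) (rearrange₅ n s x) summed)))
        where
        rearrange₄ : ∀ s e t x b → 2 * s * e + t * x * (s * b) ≡ (2 * e + t * b * x) * s
        rearrange₄ = solve-∀
        rearrange₅ : ∀ n s x → n * (2 * s * x) ≡ 2 * n * x * s
        rearrange₅ = solve-∀

    -- Once the first group has been shifted by s, the uncovered bins are `u′ s`, and the factor due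
    -- to the remaining groups depends on their sizes but not on s. It leaves the sum over s, and
    -- `φ-step` handles the first group.
    free-moment : ∀ k (u : Fin n → ℕ) (l : Fin k → Fin n → ℕ) → (∀ y → u y ≤ 1) →
      (∀ a → (∑[ z ∈ bins ] (1 ⊓ l a z)) ≤ τ) →
      (∑[ v ∈ vecs bins k ] φ t θ (free u l v)) * (2 * n) ^ (t * (∑[ a ∈ allFin k ] ∑[ z ∈ bins ] (1 ⊓ l a z)))
      ≤ φ t θ (∑ bins u) * ((2 * n ∸ 1) ^ (t * (∑[ a ∈ allFin k ] ∑[ z ∈ bins ] (1 ⊓ l a z))) * n ^ k)
    free-moment zero u l u≤1 b≤τ = ≤-reflexive (begin
      (φ t θ (∑[ y ∈ bins ] (u y * 1)) + 0) * (2 * n) ^ (t * 0)    ≡⟨ cong₂ (λ a e → (φ t θ a + 0) * (2 * n) ^ e) (∑-cong bins λ y → *-identityʳ (u y)) (*-zeroʳ t) ⟩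
      (φ t θ (∑ bins u) + 0) * 1                                   ≡⟨ cong (_* 1) (+-identityʳ (φ t θ (∑ bins u))) ⟩
      φ t θ (∑ bins u) * ((2 * n ∸ 1) ^ 0 * 1)                     ≡⟨ cong (λ e → φ t θ (∑ bins u) * ((2 * n ∸ 1) ^ e * 1)) (*-zeroʳ t) ⟨
      φ t θ (∑ bins u) * ((2 * n ∸ 1) ^ (t * 0) * 1)               ∎)
      where open ≡-Reasoning
    free-moment (suc k) u l u≤1 b≤τ = begin
      (∑[ v ∈ vecs bins (suc k) ] φ t θ (free u l v)) * (2 * n) ^ (t * b)
        ≡⟨ cong₂ _*_ (∑-vecs-suc bins k _) (pow (2 * n)) ⟩
      (∑[ s ∈ bins ] ∑[ v ∈ vecs bins k ] φ t θ (free u l (s ∷ v))) * (W₀ * W)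
        ≡⟨ cong (_* (W₀ * W)) (∑-cong bins λ s → ∑-cong (vecs bins k) λ v → cong (φ t θ) (∑-cong bins λ y →
             sym (*-assoc (u y) (1 ∸ l zero (y ⊕ s)) (∏ k (λ a → 1 ∸ l (suc a) (y ⊕ lookup v a)))))) ⟩
      (∑[ s ∈ bins ] ∑[ v ∈ vecs bins k ] φ t θ (free (u′ s) l′ v)) * (W₀ * W)
        ≡⟨ rearrange (∑[ s ∈ bins ] ∑[ v ∈ vecs bins k ] φ t θ (free (u′ s) l′ v)) W₀ W ⟩
      (∑[ s ∈ bins ] ∑[ v ∈ vecs bins k ] φ t θ (free (u′ s) l′ v)) * W * W₀
        ≡⟨ cong (_* W₀) (*-distribʳ-∑ W bins _) ⟨
      (∑[ s ∈ bins ] ((∑[ v ∈ vecs bins k ] φ t θ (free (u′ s) l′ v)) * W)) * W₀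
        ≤⟨ *-monoˡ-≤ W₀ (∑-mono bins λ s → free-moment k (u′ s) l′ (u′≤1 s) (b≤τ ∘ suc)) ⟩
      (∑[ s ∈ bins ] (φ t θ (∑ bins (u′ s)) * (V * n ^ k))) * W₀
        ≡⟨ cong (_* W₀) (*-distribʳ-∑ (V * n ^ k) bins _) ⟩
      (∑[ s ∈ bins ] φ t θ (∑ bins (u′ s))) * (V * n ^ k) * W₀
        ≡⟨ rearrange′ (∑[ s ∈ bins ] φ t θ (∑ bins (u′ s))) (V * n ^ k) W₀ ⟩
      (∑[ s ∈ bins ] φ t θ (∑ bins (u′ s))) * W₀ * (V * n ^ k)
        ≤⟨ *-monoˡ-≤ (V * n ^ k) (φ-step u (l zero) u≤1 (b≤τ zero)) ⟩
      φ t θ (∑ bins u) * (V₀ * n) * (V * n ^ k)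
        ≡⟨ rearrange″ (φ t θ (∑ bins u)) V₀ n V (n ^ k) ⟩
      φ t θ (∑ bins u) * (V₀ * V * (n * n ^ k))
        ≡⟨ cong (λ e → φ t θ (∑ bins u) * (e * n ^ suc k)) (pow (2 * n ∸ 1)) ⟨
      φ t θ (∑ bins u) * ((2 * n ∸ 1) ^ (t * b) * n ^ suc k) ∎
      where
      open ≤-Reasoning
      β : Fin (suc k) → ℕ
      β a = ∑[ z ∈ bins ] (1 ⊓ l a z)
      b = ∑ (allFin (suc k)) β
      b₀ = β zero
      b′ = ∑ (allFin k) (β ∘ suc)
      l′ = l ∘ suc
      u′ : Fin n → Fin n → ℕ
      u′ s y = u y * (1 ∸ l zero (y ⊕ s))
      u′≤1 : ∀ s y → u′ s y ≤ 1
      u′≤1 s y = *-mono-≤ (u≤1 y) (m∸n≤m 1 (l zero (y ⊕ s)))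
      W₀ = (2 * n) ^ (t * b₀)
      W = (2 * n) ^ (t * b′)
      V₀ = (2 * n ∸ 1) ^ (t * b₀)
      V = (2 * n ∸ 1) ^ (t * b′)
      pow : ∀ c → c ^ (t * b) ≡ c ^ (t * b₀) * c ^ (t * b′)
      pow c = trans (cong (c ^_) (trans (cong (t *_) (∑-allFin-suc k β)) (*-distribˡ-+ t b₀ b′)))
        (^-distribˡ-+-* c (t * b₀) (t * b′))
      rearrange : ∀ a b c → a * (b * c) ≡ a * c * b
      rearrange = solve-∀
      rearrange′ : ∀ a b c → a * b * c ≡ a * c * b
      rearrange′ = solve-∀
      rearrange″ : ∀ f v n w x → f * (v * n) * (w * x) ≡ f * (v * w * (n * x))
      rearrange″ = solve-∀

  -- Groups by the character at a position; light and heavy characters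

  module _ {c : ℕ} (w : Key c → ℕ) (i : Fin c) where

    group : Fin σ → Key c → ℕ
    group a x = w x * δ (lookup x i) a

    ∑-group : (∑[ a ∈ chars ] ∑ (keys c) (group a)) ≡ ∑ (keys c) w
    ∑-group = trans (∑-swap chars (keys c) _) (∑-cong (keys c) λ x →
      trans (*-distribˡ-∑ (w x) chars _) (trans (cong (w x *_) (∑-δ-1 (lookup x i))) (*-identityʳ (w x))))

    group≤w : ∀ a x → group a x ≤ w x
    group≤w a x = ≤-trans (*-monoʳ-≤ (w x) (𝟙≤1 (lookup x i Fin.≟ a))) (≤-reflexive (*-identityʳ (w x)))

  module _ {c : ℕ} (w : Key c → ℕ) where

    degree : Fin c → Fin σ → ℕ
    degree i a = ∑ (keys c) (group w i a)

    light : (τ : ℕ) → Fin c → Key c → ℕ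
    light τ i x = w x * 𝟙 (degree i (lookup x i) ≤? τ)

    -- Fewer than m/τ characters per position are heavy, so at most (m/τ)ᶜ ≤ m/2 keys consist of heavy characters only.
    ∃-light : .{{_ : NonZero c}} → (∀ x → w x ≤ 1) → ∀ τ .{{_ : NonZero τ}} →
      2 * ∑ (keys c) w ^ c ≤ τ ^ c * ∑ (keys c) w →
      ∃[ i ] ∑ (keys c) w ≤ 2 * c * ∑ (keys c) (light τ i)
    ∃-light w≤1 τ few = i , (begin
      m                                      ≤⟨ m≤2ℓ ⟩
      2 * ∑ (allFin c) ℓ                     ≤⟨ *-monoʳ-≤ 2 le ⟩
      2 * (c * ℓ i)                          ≡⟨ *-assoc 2 c _ ⟨
      2 * c * ℓ i                            ∎)
      where
      open ≤-Reasoning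
      m = ∑ (keys c) w
      ℓ : Fin c → ℕ
      ℓ i = ∑ (keys c) (light τ i)
      i = proj₁ (∃-∑≤k*f c ℓ)
      le = proj₂ (∃-∑≤k*f c ℓ)
      heavy : Fin c → Fin σ → ℕ
      heavy i a = 𝟙 (τ <? degree i a)
      #heavy : Fin c → ℕ
      #heavy i = ∑ chars (heavy i)
      heavy+light : ∀ i a → 1 ≤ heavy i a + 𝟙 (degree i a ≤? τ)
      heavy+light i a with degree i a ≤? τ
      ... | yes ≤τ = ≤-trans (≤-reflexive (sym (𝟙-yes (degree i a ≤? τ) ≤τ))) (m≤n+m _ _)
      ... | no  ≰τ = ≤-trans (≤-reflexive (sym (𝟙-yes (τ <? degree i a) (≰⇒> ≰τ)))) (m≤m+n _ _)
      pointwise : ∀ x → w x ≤ ∏ c (λ i → heavy i (lookup x i)) + (∑[ i ∈ allFin c ] light τ i x)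
      pointwise x = begin
        w x                 ≡⟨ *-identityʳ (w x) ⟨
        w x * 1             ≤⟨ *-monoʳ-≤ (w x) (1≤∏+∑ c (λ i → heavy i (lookup x i)) (λ i → 𝟙 (degree i (lookup x i) ≤? τ)) (λ i → heavy+light i (lookup x i))) ⟩
        w x * (h + l)       ≡⟨ *-distribˡ-+ (w x) h l ⟩
        w x * h + w x * l   ≤⟨ +-mono-≤ (≤-trans (*-monoˡ-≤ h (w≤1 x)) (≤-reflexive (*-identityˡ h))) (≤-reflexive (sym (*-distribˡ-∑ (w x) (allFin c) _))) ⟩
        h + (∑[ i ∈ allFin c ] light τ i x) ∎
        where
        h = ∏ c (λ i → heavy i (lookup x i))
        l = ∑[ i ∈ allFin c ] 𝟙 (degree i (lookup x i) ≤? τ)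
      m≤h+ℓ : m ≤ ∏ c #heavy + ∑ (allFin c) ℓ
      m≤h+ℓ = begin
        m  ≤⟨ ∑-mono (keys c) pointwise ⟩
        (∑[ x ∈ keys c ] (∏ c (λ i → heavy i (lookup x i)) + (∑[ i ∈ allFin c ] light τ i x)))  ≡⟨ ∑-distrib-+ (keys c) _ _ ⟩
        _  ≡⟨ cong₂ _+_ (∑-vecs-∏ chars c heavy) (∑-swap (keys c) (allFin c) _) ⟩
        ∏ c #heavy + ∑ (allFin c) ℓ ∎
      #heavy*τ≤m : ∀ i → #heavy i * τ ≤ m
      #heavy*τ≤m i = begin
        #heavy i * τ                        ≡⟨ *-distribʳ-∑ τ chars _ ⟨
        (∑[ a ∈ chars ] (heavy i a * τ))    ≤⟨ ∑-mono chars (λ a → 𝟙*-≤ (τ <? degree i a) <⇒≤) ⟩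
        ∑ chars (degree i)                  ≡⟨ ∑-group w i ⟩
        m                                   ∎
      2h≤m : 2 * ∏ c #heavy ≤ m
      2h≤m = *-cancelˡ-≤ (τ ^ c) {{m^n≢0 τ c}} (begin
        τ ^ c * (2 * ∏ c #heavy)      ≡⟨ rearrange (τ ^ c) (∏ c #heavy) ⟩
        2 * (∏ c #heavy * τ ^ c)      ≤⟨ *-monoʳ-≤ 2 (∏*^≤^ c #heavy #heavy*τ≤m) ⟩
        2 * m ^ c                     ≤⟨ few ⟩
        τ ^ c * m                     ∎)
        where
        rearrange : ∀ a b → a * (2 * b) ≡ 2 * (b * a)
        rearrange = solve-∀
      m≤2ℓ : m ≤ 2 * ∑ (allFin c) ℓ
      m≤2ℓ = +-cancelˡ-≤ m _ _ (begin
        m + m                                     ≡⟨ cong (m +_) (+-identityʳ m) ⟨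
        2 * m                                     ≤⟨ *-monoʳ-≤ 2 m≤h+ℓ ⟩
        2 * (∏ c #heavy + ∑ (allFin c) ℓ)         ≡⟨ *-distribˡ-+ 2 (∏ c #heavy) _ ⟩
        2 * ∏ c #heavy + 2 * ∑ (allFin c) ℓ       ≤⟨ +-monoˡ-≤ _ 2h≤m ⟩
        m + 2 * ∑ (allFin c) ℓ                    ∎)

  -- Redrawing the table at one position

  H-update : ∀ {c} (ts : Tables c) i v x →
    H (ts [ i ]≔ v) x ≡ lookup v (lookup x i) ⊕ H (ts [ i ]≔ replicate σ 0#) x
  H-update (t ∷ ts) zero    v (a ∷ x) = cong (lookup v a ⊕_)
    (sym (trans (cong (_⊕ H ts x) (lookup-replicate a 0#)) (⊕-identityˡ (H ts x))))
  H-update (t ∷ ts) (suc i) v (a ∷ x) = begin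
    lookup t a ⊕ H (ts [ i ]≔ v) x                ≡⟨ cong (lookup t a ⊕_) (H-update ts i v x) ⟩
    lookup t a ⊕ (lookup v (lookup x i) ⊕ h₀)     ≡⟨ ⊕-assoc _ _ _ ⟨
    (lookup t a ⊕ lookup v (lookup x i)) ⊕ h₀     ≡⟨ cong (_⊕ h₀) (⊕-comm _ _) ⟩
    (lookup v (lookup x i) ⊕ lookup t a) ⊕ h₀     ≡⟨ ⊕-assoc _ _ _ ⟩
    lookup v (lookup x i) ⊕ (lookup t a ⊕ h₀)     ∎
    where
    open ≡-Reasoning
    h₀ = H (ts [ i ]≔ replicate σ 0#) x

  load-mono : ∀ {c} (ts : Tables c) {w w′ : Key c → ℕ} → (∀ x → w x ≤ w′ x) → ∀ y → load ts w y ≤ load ts w′ y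
  load-mono {c} ts le y = ∑-mono (keys c) λ x → *-monoˡ-≤ _ (le x)

  empty : ∀ {c} → Tables c → (Key c → ℕ) → ℕ
  empty ts w = ∑[ y ∈ bins ] (1 ∸ load ts w y)

  module _ {c : ℕ} (w : Key c → ℕ) (i : Fin c) where

    module _ (ts : Tables c) where

      load₀ : Fin σ → Fin n → ℕ
      load₀ a = load (ts [ i ]≔ replicate σ 0#) (group w i a)

      -- The keys of a group agree at position i, so a new row v translates the whole group by the
      -- single value `lookup v a`. The zero row serves as the reference configuration.
      load-update : ∀ v a y → load (ts [ i ]≔ v) (group w i a) y ≡ load₀ a (y ⊕ lookup v a)
      load-update v a y = ∑-cong (keys c) term
        where
        term : ∀ x → group w i a x * δ (H (ts [ i ]≔ v) x) y ≡ group w i a x * δ (H (ts [ i ]≔ replicate σ 0#) x) (y ⊕ lookup v a)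
        term x with lookup x i Fin.≟ a
        ... | no  _    = trans (cong₂ _*_ (*-zeroʳ (w x)) refl) (sym (cong₂ _*_ (*-zeroʳ (w x)) refl))
        ... | yes refl = cong (w x * 1 *_) (trans (cong (λ h → δ h y) (H-update ts i v x)) (δ-⊕ _ _ y))

      -- Further keys of w′ can only fill more bins, and a bin that is empty for w′ is missed by
      -- every group of w. This justifies discarding all keys whose character at position i is
      -- heavy.
      empty≤free : ∀ {w′ : Key c → ℕ} → (∀ x → w x ≤ w′ x) → ∀ v →
        empty (ts [ i ]≔ v) w′ ≤ free (λ _ → 1) load₀ v
      empty≤free {w′} w≤w′ v = ∑-mono bins pointwise
        where
        ts′ = ts [ i ]≔ v
        pointwise : ∀ y → 1 ∸ load ts′ w′ y ≤ 1 * ∏ σ (λ a → 1 ∸ load₀ a (y ⊕ lookup v a))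
        pointwise y with load ts′ w′ y in eq
        ... | suc k = ≤-trans (≤-reflexive (0∸n≡0 k)) z≤n
        ... | zero  = ≤-reflexive (sym (trans (*-identityˡ _) (∏≡1 σ λ a → cong (1 ∸_) (n≤0⇒n≡0 (begin
          load₀ a (y ⊕ lookup v a)    ≡⟨ load-update v a y ⟨
          load ts′ (group w i a) y        ≤⟨ load-mono ts′ (λ x → ≤-trans (group≤w w i a x) (w≤w′ x)) y ⟩
          load ts′ w′ y               ≡⟨ eq ⟩
          0                           ∎)))))
          where open ≤-Reasoning

      -- Translation moves the overloaded bin to `z ⊕ lookup v a` and keeps its load. Hence overload
      -- of a group is decided by the other tables, before row i is drawn.
      overloaded-update : ∀ {d} a v → Overloaded d (ts [ i ]≔ replicate σ 0#) (group w i a) → Overloaded d (ts [ i ]≔ v) (group w i a)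
      overloaded-update {d} a v (z , lt) = z ⊕ lookup v a , subst (d <_)
        (sym (trans (load-update v a _) (cong (load₀ a) (⊕-cancelʳ z (lookup v a))))) lt

  ∑≤d*∑1⊓ : ∀ {c} d (ts : Tables c) w → ¬ Overloaded d ts w → ∑ (keys c) w ≤ d * (∑[ y ∈ bins ] (1 ⊓ load ts w y))
  ∑≤d*∑1⊓ {c} d ts w ¬over = begin
    ∑ (keys c) w                              ≡⟨ ∑-load ts w ⟨
    ∑ bins (load ts w)                        ≤⟨ ∑-mono bins (λ y → l≤d*[1⊓l] (≮⇒≥ λ lt → ¬over (y , lt))) ⟩
    (∑[ y ∈ bins ] (d * (1 ⊓ load ts w y)))   ≡⟨ *-distribˡ-∑ d bins _ ⟩
    d * (∑[ y ∈ bins ] (1 ⊓ load ts w y))     ∎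
    where open ≤-Reasoning

  -- s > n (1 − 1/n)^(m/β)
  Large : (β m s : ℕ) → Set
  Large β m s = n ^ β * (n ∸ 1) ^ m < s ^ β * n ^ m

  large? : ∀ β m s → Dec (Large β m s)
  large? β m s = _ <? _

  -- Failure probability for a fixed set of keys

  module Tail (c g Q T B τ : ℕ)
    .{{_ : NonZero c}} .{{_ : NonZero Q}} .{{_ : NonZero T}} .{{_ : NonZero τ}}
    (2≤n : 2 ≤ n) (2≤B : 2 ≤ B)
    where

    -- d is the load bound, so light groups with at least m/2c keys have images of total size M ≥
    -- m/2cd, and D = 8cd makes M D ≥ 4 m. The factor B in β leaves Q^(-B) after a D-th root. As
    -- `Large` compares β-th powers, t is a multiple of β; t′ = 2 Q² turns n ≤ 2 Q m into m t′ ≥ n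
    -- Q.
    d D β t′ t θ : ℕ
    d  = T ^ c
    D  = 8 * (c * d)
    β  = D * B
    t′ = 2 * (Q * Q)
    t  = β * t′
    θ  = t * τ

    instance
      private
        d≢0 : NonZero d
        d≢0 = m^n≢0 T c
        D≢0 : NonZero D
        D≢0 = m*n≢0 8 (c * d) {{_}} {{m*n≢0 c d}}
        B≢0 : NonZero B
        B≢0 = >-nonZero (<⇒≤ 2≤B)
        β≢0 : NonZero β
        β≢0 = m*n≢0 D B
        t′≢0 : NonZero t′
        t′≢0 = m*n≢0 2 (Q * Q) {{_}} {{m*n≢0 Q Q}}
        t≢0 : NonZero t
        t≢0 = m*n≢0 β t′
        θ≢0 : NonZero θ
        θ≢0 = m*n≢0 t τ

    module _ (θQ≤n : θ * Q ≤ n) (n^g≤2^Q : n ^ g ≤ 2 ^ Q) (n^[1+g]≤Q^B : n ^ suc g ≤ Q ^ B) where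

      ones : Fin n → ℕ
      ones _ = 1

      free-tail : (l : Fin σ → Fin n → ℕ) (m : ℕ) → (∀ a → (∑[ z ∈ bins ] (1 ⊓ l a z)) ≤ τ) →
        n ≤ 2 * (Q * m) → m ≤ 2 * (c * d) * (∑[ a ∈ chars ] ∑[ z ∈ bins ] (1 ⊓ l a z)) →
        (∑[ v ∈ rows ] 𝟙 (large? β m (free ones l v))) * n ^ g ≤ N
      free-tail l m b≤τ n≤2Qm m≤2cdM with θ ^ β * n ^ m ≤? n ^ β * (n ∸ 1) ^ m
      ... | yes θ≤target = ≤-trans (*-monoʳ-≤ E n^g≤2^Q) (moment-tail 2≤n Q j (t * M) {E} nQ≤j 8j≤tM bound)
        where
        open ≤-Reasoning
        M = ∑[ a ∈ chars ] ∑[ z ∈ bins ] (1 ⊓ l a z)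
        E = ∑[ v ∈ rows ] 𝟙 (large? β m (free ones l v))
        j = m * t′
        nQ≤j : n * Q ≤ j
        nQ≤j = begin
          n * Q              ≤⟨ *-monoˡ-≤ Q n≤2Qm ⟩
          2 * (Q * m) * Q    ≡⟨ rearrange Q m ⟩
          m * (2 * (Q * Q))  ∎
          where
          rearrange : ∀ Q m → 2 * (Q * m) * Q ≡ m * (2 * (Q * Q))
          rearrange = solve-∀
        8j≤tM : 8 * j ≤ t * M
        8j≤tM = begin
          8 * (m * t′)                       ≤⟨ *-monoʳ-≤ 8 (*-monoˡ-≤ t′ m≤2cdM) ⟩
          8 * (2 * (c * d) * M * t′)         ≡⟨ rearrange (c * d) M t′ ⟩
          8 * (c * d) * t′ * M * 2           ≤⟨ *-monoʳ-≤ (8 * (c * d) * t′ * M) 2≤B ⟩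
          8 * (c * d) * t′ * M * B           ≡⟨ rearrange′ (c * d) t′ M B ⟩
          8 * (c * d) * B * t′ * M           ∎
          where
          rearrange : ∀ a M u → 8 * (2 * a * M * u) ≡ 8 * a * u * M * 2
          rearrange = solve-∀
          rearrange′ : ∀ a u M B → 8 * a * u * M * B ≡ 8 * a * B * u * M
          rearrange′ = solve-∀
        -- Markov's inequality for the t-th power: raising `Large` to the power t′ puts s ^ t on the
        -- right, and the truncation is harmless because the target is at least θ.
        pointwise : ∀ s → 𝟙 (large? β m s) * (n ^ t * (n ∸ 1) ^ j) ≤ φ t θ s * n ^ j
        pointwise s = 𝟙*-≤ (large? β m s) λ large → begin
          n ^ t * (n ∸ 1) ^ j                    ≡⟨ cong₂ _*_ (^-*-assoc n β t′) (^-*-assoc (n ∸ 1) m t′) ⟨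
          (n ^ β) ^ t′ * ((n ∸ 1) ^ m) ^ t′      ≡⟨ ^-distribʳ-* t′ (n ^ β) _ ⟨
          (n ^ β * (n ∸ 1) ^ m) ^ t′             ≤⟨ ^-monoˡ-≤ t′ (<⇒≤ large) ⟩
          (s ^ β * n ^ m) ^ t′                   ≡⟨ ^-distribʳ-* t′ (s ^ β) _ ⟩
          (s ^ β) ^ t′ * (n ^ m) ^ t′            ≡⟨ cong₂ _*_ (^-*-assoc s β t′) (^-*-assoc n m t′) ⟩
          s ^ t * n ^ j                          ≡⟨ cong (_* n ^ j) (*-identityˡ (s ^ t)) ⟨
          1 * s ^ t * n ^ j                      ≡⟨ cong (λ e → e * s ^ t * n ^ j) (𝟙-yes (θ ≤? s) (θ≤s large)) ⟨
          φ t θ s * n ^ j                        ∎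
          where
          θ≤s : Large β m s → θ ≤ s
          θ≤s large = ^-cancelʳ-≤ β (*-cancelʳ-≤ _ _ (n ^ m) {{m^n≢0 n m}} (≤-trans θ≤target (<⇒≤ large)))
        bound : E * ((n ∸ 1) ^ j * (2 * n) ^ (t * M)) ≤ n ^ j * ((2 * n ∸ 1) ^ (t * M) * N)
        bound = *-cancelˡ-≤ (n ^ t) {{m^n≢0 n t}} (begin
          n ^ t * (E * ((n ∸ 1) ^ j * w))                          ≡⟨ rearrange₁ (n ^ t) E ((n ∸ 1) ^ j) w ⟩
          E * (n ^ t * (n ∸ 1) ^ j) * w                            ≡⟨ cong (_* w) (*-distribʳ-∑ (n ^ t * (n ∸ 1) ^ j) rows _) ⟨
          (∑[ v ∈ rows ] (𝟙 (large? β m (free ones l v)) * (n ^ t * (n ∸ 1) ^ j))) * w  ≤⟨ *-monoˡ-≤ w (∑-mono rows λ v → pointwise (free ones l v)) ⟩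
          (∑[ v ∈ rows ] (φ t θ (free ones l v) * n ^ j)) * w      ≡⟨ cong (_* w) (*-distribʳ-∑ (n ^ j) rows _) ⟩
          (∑[ v ∈ rows ] φ t θ (free ones l v)) * n ^ j * w        ≡⟨ rearrange₂ (∑[ v ∈ rows ] φ t θ (free ones l v)) (n ^ j) w ⟩
          n ^ j * ((∑[ v ∈ rows ] φ t θ (free ones l v)) * w)      ≤⟨ *-monoʳ-≤ (n ^ j) (free-moment t θ τ (λ z≤τ _ θ≤s → ≤-trans (*-monoʳ-≤ t z≤τ) θ≤s) σ ones l (λ _ → ≤-refl) b≤τ) ⟩
          n ^ j * (φ t θ (∑ bins ones) * ((2 * n ∸ 1) ^ (t * M) * N)) ≤⟨ *-monoʳ-≤ (n ^ j) (*-monoˡ-≤ _ φn≤n^t) ⟩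
          n ^ j * (n ^ t * ((2 * n ∸ 1) ^ (t * M) * N))            ≡⟨ rearrange₃ (n ^ j) (n ^ t) _ ⟩
          n ^ t * (n ^ j * ((2 * n ∸ 1) ^ (t * M) * N))            ∎)
          where
          w = (2 * n) ^ (t * M)
          φn≤n^t : φ t θ (∑ bins ones) ≤ n ^ t
          φn≤n^t = 𝟙*-≤ (θ ≤? ∑ bins ones) λ _ → ≤-reflexive (cong (_^ t) (trans (∑-allFin-const n 1) (*-identityʳ n)))
          rearrange₁ : ∀ a b c d → a * (b * (c * d)) ≡ b * (a * c) * d
          rearrange₁ = solve-∀
          rearrange₂ : ∀ a b c → a * b * c ≡ b * (a * c)
          rearrange₂ = solve-∀
          rearrange₃ : ∀ a b c → a * (b * c) ≡ b * (a * c)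
          rearrange₃ = solve-∀
      -- The mean number of uncovered bins is at most n (1 - 1/2n)^M ≤ n Q^(-B) ≤ n^(-g); the
      -- exponent 1 + g of the hypothesis on Q ^ B pays for the factor n.
      ... | no target<θ = *-cancelʳ-≤ _ _ w {{m^n≢0 (2 * n) M {{m*n≢0 2 n}}}} (begin
          E * n ^ g * w                                   ≡⟨ rearrange₁ E (n ^ g) w ⟩
          n ^ g * (E * w)                                 ≤⟨ *-monoʳ-≤ (n ^ g) first-moment ⟩
          n ^ g * (n * ((2 * n ∸ 1) ^ M * N))             ≡⟨ rearrange₂ (n ^ g) n ((2 * n ∸ 1) ^ M) N ⟩
          N * ((2 * n ∸ 1) ^ M * n ^ suc g)               ≤⟨ *-monoʳ-≤ N (*-monoʳ-≤ ((2 * n ∸ 1) ^ M) n^[1+g]≤Q^B) ⟩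
          N * ((2 * n ∸ 1) ^ M * Q ^ B)                   ≤⟨ *-monoʳ-≤ N (small-target-decay 2≤n Q D B m M θ 4m≤MD θQ≤n (<⇒≤ (≰⇒> target<θ))) ⟩
          N * w                                           ∎)
        where
        open ≤-Reasoning
        M = ∑[ a ∈ chars ] ∑[ z ∈ bins ] (1 ⊓ l a z)
        E = ∑[ v ∈ rows ] 𝟙 (large? β m (free ones l v))
        w = (2 * n) ^ M
        rearrange₁ : ∀ a b c → a * b * c ≡ b * (a * c)
        rearrange₁ = solve-∀
        rearrange₂ : ∀ a n b N → a * (n * (b * N)) ≡ N * (b * (n * a))
        rearrange₂ = solve-∀
        4m≤MD : 4 * m ≤ M * D
        4m≤MD = ≤-trans (*-monoʳ-≤ 4 m≤2cdM) (≤-reflexive (rearrange (c * d) M))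
          where
          rearrange : ∀ a M → 4 * (2 * a * M) ≡ M * (8 * a)
          rearrange = solve-∀
        -- `Large` rules out s = 0 because β is positive, so failure means at least one uncovered
        -- bin, and φ 1 1 s is s itself.
        pointwise : ∀ s → 𝟙 (large? β m s) ≤ φ 1 1 s
        pointwise zero = 𝟙-≤ (large? β m 0) λ large →
          contradiction (subst (λ e → n ^ β * (n ∸ 1) ^ m < e * n ^ m) (0^k≡0 β) large) λ ()
        pointwise s@(suc _) = ≤-trans (𝟙≤1 (large? β m s)) (s≤s z≤n)
        first-moment : E * w ≤ n * ((2 * n ∸ 1) ^ M * N)
        first-moment = begin
          E * w                                                     ≤⟨ *-monoˡ-≤ w (∑-mono rows λ v → pointwise (free ones l v)) ⟩
          (∑[ v ∈ rows ] φ 1 1 (free ones l v)) * w                 ≡⟨ cong (λ e → (∑[ v ∈ rows ] φ 1 1 (free ones l v)) * (2 * n) ^ e) (*-identityˡ M) ⟨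
          (∑[ v ∈ rows ] φ 1 1 (free ones l v)) * (2 * n) ^ (1 * M) ≤⟨ free-moment 1 1 τ (λ _ z≤s _ → ≤-trans (≤-reflexive (*-identityˡ _)) z≤s) σ ones l (λ _ → ≤-refl) b≤τ ⟩
          φ 1 1 (∑ bins ones) * ((2 * n ∸ 1) ^ (1 * M) * N)         ≤⟨ *-monoˡ-≤ _ φn≤n ⟩
          n * ((2 * n ∸ 1) ^ (1 * M) * N)                           ≡⟨ cong (λ e → n * ((2 * n ∸ 1) ^ e * N)) (*-identityˡ M) ⟩
          n * ((2 * n ∸ 1) ^ M * N)                                 ∎
          where
          φn≤n : φ 1 1 (∑ bins ones) ≤ n
          φn≤n = 𝟙*-≤ (1 ≤? ∑ bins ones) λ _ → ≤-reflexive (trans (*-identityʳ _) (trans (∑-allFin-const n 1) (*-identityʳ n)))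

      module _ (w : Key c → ℕ) (w≤1 : ∀ x → w x ≤ 1) (m : ℕ) (∑w≡m : ∑ (keys c) w ≡ m) where

        -- The bound for one set is proportional to its size, so a union bound over sets with at
        -- most m keys altogether costs no more than one set of m keys.
        overload-union : (2 * c * n * m * n ^ g ≤ Q ^ T) → {k : ℕ} (ws : Fin k → Key c → ℕ) →
          (∀ a x → ws a x ≤ 1) → (∀ a → 2 * (Q * ∑ (keys c) (ws a)) ≤ n) → (∑[ a ∈ allFin k ] ∑ (keys c) (ws a)) ≤ m →
          (∑[ ts ∈ tabs c ] ∑[ a ∈ allFin k ] 𝟙 (overloaded? d ts (ws a))) * n ^ g ≤ N ^ c
        overload-union Q^T≥ {k} ws ws≤1 small ∑ws≤m = *-cancelʳ-≤ _ _ (Q ^ T) {{m^n≢0 Q T}} (begin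
          O * n ^ g * Q ^ T              ≡⟨ rearrange O (n ^ g) (Q ^ T) ⟩
          O * Q ^ T * n ^ g              ≤⟨ *-monoˡ-≤ (n ^ g) O*Q^T≤ ⟩
          2 * c * n * m * N ^ c * n ^ g  ≡⟨ rearrange (2 * c * n * m) (N ^ c) (n ^ g) ⟩
          2 * c * n * m * n ^ g * N ^ c  ≤⟨ *-monoˡ-≤ (N ^ c) Q^T≥ ⟩
          Q ^ T * N ^ c                  ≡⟨ *-comm (Q ^ T) (N ^ c) ⟩
          N ^ c * Q ^ T                  ∎)
          where
          open ≤-Reasoning
          rearrange : ∀ a b c → a * b * c ≡ a * c * b
          rearrange = solve-∀
          O = ∑[ ts ∈ tabs c ] ∑[ a ∈ allFin k ] 𝟙 (overloaded? d ts (ws a))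
          O*Q^T≤ : O * Q ^ T ≤ 2 * c * n * m * N ^ c
          O*Q^T≤ = begin
            O * Q ^ T
              ≡⟨ cong (_* Q ^ T) (∑-swap (tabs c) (allFin k) _) ⟩
            (∑[ a ∈ allFin k ] ∑[ ts ∈ tabs c ] 𝟙 (overloaded? d ts (ws a))) * Q ^ T
              ≡⟨ *-distribʳ-∑ (Q ^ T) (allFin k) _ ⟨
            (∑[ a ∈ allFin k ] ((∑[ ts ∈ tabs c ] 𝟙 (overloaded? d ts (ws a))) * Q ^ T))
              ≤⟨ ∑-mono (allFin k) (λ a → overload-bound Q T c (ws a) (ws≤1 a) (small a)) ⟩
            (∑[ a ∈ allFin k ] (2 * c * n * ∑ (keys c) (ws a) * N ^ c))
              ≡⟨ trans (*-distribʳ-∑ (N ^ c) (allFin k) _) (cong (_* N ^ c) (*-distribˡ-∑ (2 * c * n) (allFin k) _)) ⟩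
            2 * c * n * (∑[ a ∈ allFin k ] ∑ (keys c) (ws a)) * N ^ c
              ≤⟨ *-monoˡ-≤ (N ^ c) (*-monoʳ-≤ (2 * c * n) ∑ws≤m) ⟩
            2 * c * n * m * N ^ c ∎

        -- Without overload the keys occupy h ≥ m/d ≥ m/β bins, and Bernoulli gives n - h ≤ n (1 -
        -- 1/n)^h ≤ n (1 - 1/n)^(m/β).
        few-keys : 2 * c * n * m * n ^ g ≤ Q ^ T → 2 * (Q * m) ≤ n →
          (∑[ ts ∈ tabs c ] 𝟙 (large? β m (empty ts w))) * n ^ g ≤ N ^ c
        few-keys Q^T≥ 2Qm≤n = ≤-trans
          (*-monoˡ-≤ (n ^ g) (∑-mono (tabs c) λ ts → ≤-trans (large≤over ts) (≤-reflexive (sym (+-identityʳ _)))))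
          (overload-union Q^T≥ {1} (λ _ → w) (λ _ → w≤1)
            (λ _ → subst (λ e → 2 * (Q * e) ≤ n) (sym ∑w≡m) 2Qm≤n) (≤-reflexive (trans (+-identityʳ _) ∑w≡m)))
          where
          open ≤-Reasoning
          d≤β : d ≤ β
          d≤β = begin
            d                 ≤⟨ m≤n*m d c ⟩
            c * d             ≤⟨ m≤n*m (c * d) 8 ⟩
            D                 ≤⟨ m≤m*n D B ⟩
            β                 ∎
          not-large : ∀ {h e} → h + e ≡ n → m ≤ β * h → ¬ Large β m e
          not-large {h} {e} h+e≡n m≤βh = ≤⇒≯ (*-cancelʳ-≤ _ _ (n ^ i) {{m^n≢0 n i}} (begin
            e ^ β * n ^ m * n ^ i                 ≡⟨ *-assoc (e ^ β) _ _ ⟩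
            e ^ β * (n ^ m * n ^ i)               ≡⟨ cong (e ^ β *_) (merge n) ⟩
            e ^ β * (n ^ h) ^ β                   ≡⟨ ^-distribʳ-* β e (n ^ h) ⟨
            (e * n ^ h) ^ β                       ≤⟨ ^-monoˡ-≤ β (subst (λ e → e * n ^ h ≤ n * (n ∸ 1) ^ h) n∸h≡e (bernoulli-∸ n h)) ⟩
            (n * (n ∸ 1) ^ h) ^ β                 ≡⟨ ^-distribʳ-* β n _ ⟩
            n ^ β * ((n ∸ 1) ^ h) ^ β             ≡⟨ cong (n ^ β *_) (merge (n ∸ 1)) ⟨
            n ^ β * ((n ∸ 1) ^ m * (n ∸ 1) ^ i)   ≤⟨ *-monoʳ-≤ (n ^ β) (*-monoʳ-≤ ((n ∸ 1) ^ m) (^-monoˡ-≤ i (m∸n≤m n 1))) ⟩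
            n ^ β * ((n ∸ 1) ^ m * n ^ i)         ≡⟨ *-assoc (n ^ β) _ _ ⟨
            n ^ β * (n ∸ 1) ^ m * n ^ i           ∎))
            where
            i = β * h ∸ m
            merge : ∀ a → a ^ m * a ^ i ≡ (a ^ h) ^ β
            merge a = trans (sym (^-distribˡ-+-* a m i)) (trans (cong (a ^_) (trans (m+[n∸m]≡n m≤βh) (*-comm β h))) (sym (^-*-assoc a h β)))
            n∸h≡e : n ∸ h ≡ e
            n∸h≡e = trans (cong (_∸ h) (sym h+e≡n)) (m+n∸m≡n h e)
          large≤over : ∀ ts → 𝟙 (large? β m (empty ts w)) ≤ 𝟙 (overloaded? d ts w)
          large≤over ts with overloaded? d ts w
          ... | yes _    = 𝟙≤1 (large? β m (empty ts w))
          ... | no ¬over = ≤-reflexive (𝟙-no (large? β m (empty ts w)) (not-large full (begin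
            m                                        ≡⟨ ∑w≡m ⟨
            ∑ (keys c) w                             ≤⟨ ∑≤d*∑1⊓ d ts w ¬over ⟩
            d * (∑[ y ∈ bins ] (1 ⊓ load ts w y))    ≤⟨ *-monoˡ-≤ _ d≤β ⟩
            β * (∑[ y ∈ bins ] (1 ⊓ load ts w y))    ∎)))
            where
            full : (∑[ y ∈ bins ] (1 ⊓ load ts w y)) + empty ts w ≡ n
            full = trans (sym (∑-distrib-+ bins _ _)) (trans (∑-cong bins λ y → 1⊓k+[1∸k]≡1 (load ts w y)) (trans (∑-allFin-const n 1) (*-identityʳ n)))

        -- Two kinds of failure, an overloaded light group and too many bins missed by the light
        -- groups, each concern at most the fraction n^(-g) of the tables; hence the factor 2.
        -- Redrawing row i multiplies all counts by N.
        many-keys : 2 * c * n * m * n ^ g ≤ Q ^ T → 2 * m ^ c ≤ τ ^ c * m → 2 * (Q * τ) ≤ n → n ≤ 2 * (Q * m) →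
          (∑[ ts ∈ tabs c ] 𝟙 (large? β m (empty ts w))) * n ^ g ≤ 2 * N ^ c
        many-keys Q^T≥ few 2Qτ≤n n≤2Qm with ∃-light w w≤1 τ (subst (λ e → 2 * e ^ c ≤ τ ^ c * e) (sym ∑w≡m) few)
        ... | i , ∑w≤2cℓ = *-cancelˡ-≤ N {{m^n≢0 n σ}} (begin
          N * (E * n ^ g)                                  ≡⟨ *-assoc N E (n ^ g) ⟨
          N * E * n ^ g                                    ≡⟨ cong (λ e → e * E * n ^ g) length-rows ⟨
          length rows * E * n ^ g                          ≡⟨ cong (_* n ^ g) (∑-resample rows c i L) ⟨
          (∑[ ts ∈ tabs c ] ∑[ v ∈ rows ] L (ts [ i ]≔ v)) * n ^ g            ≡⟨ *-distribʳ-∑ (n ^ g) (tabs c) _ ⟨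
          (∑[ ts ∈ tabs c ] ((∑[ v ∈ rows ] L (ts [ i ]≔ v)) * n ^ g))        ≤⟨ ∑-mono (tabs c) row-bound ⟩
          (∑[ ts ∈ tabs c ] ((∑[ v ∈ rows ] O (ts [ i ]≔ v)) * n ^ g + N))    ≡⟨ ∑-distrib-+ (tabs c) _ _ ⟩
          (∑[ ts ∈ tabs c ] ((∑[ v ∈ rows ] O (ts [ i ]≔ v)) * n ^ g)) + (∑[ ts ∈ tabs c ] N)
            ≡⟨ cong₂ _+_ (trans (*-distribʳ-∑ (n ^ g) (tabs c) _) (cong (_* n ^ g) (∑-resample rows c i O)))
                 (trans (∑-const (tabs c) N) (cong (_* N) (length-tabs c))) ⟩
          length rows * ∑ (tabs c) O * n ^ g + N ^ c * N   ≡⟨ cong (λ e → e * ∑ (tabs c) O * n ^ g + N ^ c * N) length-rows ⟩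
          N * ∑ (tabs c) O * n ^ g + N ^ c * N             ≡⟨ rearrange N (∑ (tabs c) O) (n ^ g) (N ^ c) ⟩
          N * (∑ (tabs c) O * n ^ g + N ^ c)               ≤⟨ *-monoʳ-≤ N (+-monoˡ-≤ (N ^ c) (overload-union Q^T≥ G G≤1 small ∑G≤m)) ⟩
          N * (N ^ c + N ^ c)                              ≡⟨ cong (λ e → N * (N ^ c + e)) (+-identityʳ (N ^ c)) ⟨
          N * (2 * N ^ c)                                  ∎)
          where
          open ≤-Reasoning
          rearrange : ∀ N o x y → N * o * x + y * N ≡ N * (o * x + y)
          rearrange = solve-∀
          w′ : Key c → ℕ
          w′ = light w τ i
          w′≤w : ∀ x → w′ x ≤ w x
          w′≤w x = ≤-trans (*-monoʳ-≤ (w x) (𝟙≤1 (degree w i (lookup x i) ≤? τ))) (≤-reflexive (*-identityʳ (w x)))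
          G : Fin σ → Key c → ℕ
          G = group w′ i
          G≤1 : ∀ a x → G a x ≤ 1
          G≤1 a x = ≤-trans (group≤w w′ i a x) (≤-trans (w′≤w x) (w≤1 x))
          L O : Tables c → ℕ
          L ts = 𝟙 (large? β m (empty ts w))
          O ts = ∑[ a ∈ chars ] 𝟙 (overloaded? d ts (G a))
          E = ∑ (tabs c) L
          ∑G≤m : (∑[ a ∈ chars ] ∑ (keys c) (G a)) ≤ m
          ∑G≤m = begin
            (∑[ a ∈ chars ] ∑ (keys c) (G a))   ≡⟨ ∑-group w′ i ⟩
            ∑ (keys c) w′                       ≤⟨ ∑-mono (keys c) w′≤w ⟩
            ∑ (keys c) w                        ≡⟨ ∑w≡m ⟩
            m                                   ∎
          -- A heavy character has an empty group, since `light` has removed its keys.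
          |G|≤τ : ∀ a → ∑ (keys c) (G a) ≤ τ
          |G|≤τ a with degree w i a ≤? τ
          ... | yes ≤τ = ≤-trans (∑-mono (keys c) λ x → *-monoˡ-≤ _ (w′≤w x)) ≤τ
          ... | no  ≰τ = ≤-trans (≤-reflexive (∑-zero (keys c) vanish)) z≤n
            where
            vanish : ∀ x → G a x ≡ 0
            vanish x with lookup x i Fin.≟ a
            ... | no _     = *-zeroʳ (w′ x)
            ... | yes refl = trans (*-identityʳ (w′ x)) (trans (cong (w x *_) (𝟙-no (degree w i a ≤? τ) ≰τ)) (*-zeroʳ (w x)))
          small : ∀ a → 2 * (Q * ∑ (keys c) (G a)) ≤ n
          small a = ≤-trans (*-monoʳ-≤ 2 (*-monoʳ-≤ Q (|G|≤τ a))) 2Qτ≤n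
          -- Overload does not depend on row i: either every v is charged to `O`, or no group is
          -- overloaded for any v and `free-tail` applies.
          row-bound : ∀ ts → (∑[ v ∈ rows ] L (ts [ i ]≔ v)) * n ^ g ≤ (∑[ v ∈ rows ] O (ts [ i ]≔ v)) * n ^ g + N
          row-bound ts with Fin.any? (λ a → overloaded? d (ts [ i ]≔ replicate σ 0#) (G a))
          ... | yes (a , over) = ≤-trans (*-monoˡ-≤ (n ^ g) (∑-mono rows λ v → begin
            L (ts [ i ]≔ v)                         ≤⟨ 𝟙≤1 (large? β m (empty (ts [ i ]≔ v) w)) ⟩
            1                                       ≡⟨ 𝟙-yes (overloaded? d (ts [ i ]≔ v) (G a)) (overloaded-update w′ i ts a v over) ⟨
            𝟙 (overloaded? d (ts [ i ]≔ v) (G a))   ≤⟨ ∈⇒≤∑ (λ a → 𝟙 (overloaded? d (ts [ i ]≔ v) (G a))) (∈-allFin a) ⟩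
            O (ts [ i ]≔ v)                         ∎)) (m≤m+n _ N)
          ... | no ¬over = begin
            (∑[ v ∈ rows ] L (ts [ i ]≔ v)) * n ^ g                       ≤⟨ *-monoˡ-≤ (n ^ g) (∑-mono rows λ v → large-mono (empty≤free w′ i ts w′≤w v)) ⟩
            (∑[ v ∈ rows ] 𝟙 (large? β m (free ones l v))) * n ^ g        ≤⟨ free-tail l m b≤τ n≤2Qm m≤2cdM ⟩
            N                                                             ≤⟨ m≤n+m N _ ⟩
            (∑[ v ∈ rows ] O (ts [ i ]≔ v)) * n ^ g + N                   ∎
            where
            l : Fin σ → Fin n → ℕ
            l = load₀ w′ i ts
            large-mono : ∀ {s s′} → s ≤ s′ → 𝟙 (large? β m s) ≤ 𝟙 (large? β m s′)
            large-mono {s} {s′} s≤s′ = 𝟙-≤ (large? β m s) λ large →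
              ≤-reflexive (sym (𝟙-yes (large? β m s′) (≤-trans large (*-monoˡ-≤ (n ^ m) (^-monoˡ-≤ β s≤s′)))))
            b≤τ : ∀ a → (∑[ z ∈ bins ] (1 ⊓ l a z)) ≤ τ
            b≤τ a = begin
              (∑[ z ∈ bins ] (1 ⊓ l a z))   ≤⟨ ∑-mono bins (λ z → m⊓n≤n 1 (l a z)) ⟩
              ∑ bins (l a)                  ≡⟨ ∑-load (ts [ i ]≔ replicate σ 0#) (G a) ⟩
              ∑ (keys c) (G a)              ≤⟨ |G|≤τ a ⟩
              τ                             ∎
            m≤2cdM : m ≤ 2 * (c * d) * (∑[ a ∈ chars ] ∑[ z ∈ bins ] (1 ⊓ l a z))
            m≤2cdM = begin
              m                                         ≡⟨ ∑w≡m ⟨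
              ∑ (keys c) w                              ≤⟨ ∑w≤2cℓ ⟩
              2 * c * ∑ (keys c) w′                     ≡⟨ cong (2 * c *_) (∑-group w′ i) ⟨
              2 * c * (∑[ a ∈ chars ] ∑ (keys c) (G a)) ≤⟨ *-monoʳ-≤ (2 * c) (∑-mono chars λ a → ∑≤d*∑1⊓ d (ts [ i ]≔ replicate σ 0#) (G a) λ over → ¬over (a , over)) ⟩
              2 * c * (∑[ a ∈ chars ] (d * (∑[ z ∈ bins ] (1 ⊓ l a z)))) ≡⟨ cong (2 * c *_) (*-distribˡ-∑ d chars _) ⟩
              2 * c * (d * M)                           ≡⟨ reassoc c d M ⟩
              2 * (c * d) * M                           ∎
              where
              M = ∑[ a ∈ chars ] ∑[ z ∈ bins ] (1 ⊓ l a z)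
              reassoc : ∀ c d M → 2 * c * (d * M) ≡ 2 * (c * d) * M
              reassoc = solve-∀

-- Choice of the parameters

module Parameters (c′ g : ℕ) where

  -- L = 6c and τ = Q^(L-4) meet two constraints: θ Q = 2 β Q³ τ ≤ Q⁴ τ ≤ n, and 2 m^(c-1) ≤ τ^c for
  -- m ≤ Q^(L+2), which holds if (L + 2)(c - 1) + 1 ≤ (L - 4) c, that is L ≥ 6c - 1. As n ≤ Q^(L+1),
  -- B gives Q^B ≥ n^(1+g); T adds L + 2 for m and 1 for the factor 2c. A is the exponent in n^β ≤
  -- Q^A, and from q₀ on A (q + 1) < 2^q.
  c L B T d D β A q₀ r₀ : ℕ
  c  = suc c′
  L  = 6 * c
  B  = suc L * suc g
  T  = B + (L + 3)
  d  = T ^ c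
  D  = 8 * (c * d)
  β  = D * B
  A  = suc L * β
  q₀ = 2 * A + 5
  r₀ = q₀ * L

  instance
    private
      d≢0 : NonZero d
      d≢0 = m^n≢0 T c
      D≢0 : NonZero D
      D≢0 = m*n≢0 8 (c * d) {{_}} {{m*n≢0 c d}}
    β≢0 : NonZero β
    β≢0 = m*n≢0 D B

  2≤B : 2 ≤ B
  2≤B = ≤-trans (s≤s (>-nonZero⁻¹ L)) (m≤m*n (suc L) (suc g))

  c≤β : c ≤ β
  c≤β = begin
    c         ≤⟨ m≤m*n c d ⟩
    c * d     ≤⟨ m≤n*m (c * d) 8 ⟩
    D         ≤⟨ m≤m*n D B ⟩
    β         ∎
    where open ≤-Reasoning

  g≤β : g ≤ β
  g≤β = begin
    g          ≤⟨ n≤1+n g ⟩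
    suc g      ≤⟨ m≤n*m (suc g) (suc L) ⟩
    B          ≤⟨ m≤n*m B D ⟩
    β          ∎
    where open ≤-Reasoning

  module _ (r : ℕ) (r₀≤r : r₀ ≤ r) where

    open ≤-Reasoning

    n q Q τ : ℕ
    n = 2 ^ r
    q = r / L
    Q = 2 ^ q
    τ = Q ^ (6 * c′ + 2)

    instance
      n≢0 : NonZero n
      n≢0 = m^n≢0 2 r
      Q≢0 : NonZero Q
      Q≢0 = m^n≢0 2 q
      τ≢0 : NonZero τ
      τ≢0 = m^n≢0 Q (6 * c′ + 2)

    q₀≤q : q₀ ≤ q
    q₀≤q = subst (_≤ q) (m*n/n≡m q₀ L) (/-monoˡ-≤ L r₀≤r)

    A[1+q]<Q : A * suc q < Q
    A[1+q]<Q = a*[1+q]<2^q A (≤⇒≤′ q₀≤q)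

    2β≤Q : 2 * β ≤ Q
    2β≤Q = begin
      2 * β         ≤⟨ *-monoˡ-≤ β (s≤s (>-nonZero⁻¹ L)) ⟩
      A             ≤⟨ m≤m*n A (suc q) ⟩
      A * suc q     ≤⟨ <⇒≤ A[1+q]<Q ⟩
      Q             ∎

    2≤Q : 2 ≤ Q
    2≤Q = ≤-trans (m≤m*n 2 β) 2β≤Q

    L≤q : L ≤ q
    L≤q = begin
      L             ≤⟨ n≤1+n L ⟩
      suc L         ≤⟨ m≤m*n (suc L) β ⟩
      A             ≤⟨ m≤n*m A 2 ⟩
      2 * A         ≤⟨ m≤m+n (2 * A) 5 ⟩
      q₀            ≤⟨ q₀≤q ⟩
      q             ∎

    Q^L≤n : Q ^ L ≤ n
    Q^L≤n = begin
      Q ^ L                 ≡⟨ ^-*-assoc 2 q L ⟩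
      2 ^ (q * L)           ≤⟨ ^-monoʳ-≤ 2 (subst (q * L ≤_) (sym (m≡m%n+[m/n]*n r L)) (m≤n+m (q * L) (r % L))) ⟩
      n                     ∎

    -- The remainder of r modulo L is below L ≤ q, so rounding r/L down costs at most one factor Q.
    n≤Q^[1+L] : n ≤ Q ^ suc L
    n≤Q^[1+L] = begin
      2 ^ r                 ≡⟨ cong (2 ^_) (m≡m%n+[m/n]*n r L) ⟩
      2 ^ (r % L + q * L)   ≤⟨ ^-monoʳ-≤ 2 (+-monoˡ-≤ (q * L) (≤-trans (<⇒≤ (m%n<n r L)) L≤q)) ⟩
      2 ^ (q + q * L)       ≡⟨ cong (2 ^_) (*-suc q L) ⟨
      2 ^ (q * suc L)       ≡⟨ ^-*-assoc 2 q (suc L) ⟨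
      Q ^ suc L             ∎

    2≤n : 2 ≤ n
    2≤n = ≤-trans 2≤Q (≤-trans (subst (_≤ Q ^ L) (^-identityʳ Q) (^-monoʳ-≤ Q (>-nonZero⁻¹ L))) Q^L≤n)

    -- n^β is at most a fixed power of Q, namely 2^(qA), whereas Q = 2^q exceeds A (q + 1). Thus
    -- 2^(-Q) is below the required failure probability, and also below the level at which the
    -- target drops under one bin.
    n^β<2^Q : n ^ β < 2 ^ Q
    n^β<2^Q = begin-strict
      n ^ β                 ≤⟨ ^-monoˡ-≤ β n≤Q^[1+L] ⟩
      (Q ^ suc L) ^ β       ≡⟨ ^-*-assoc Q (suc L) β ⟩
      Q ^ A                 ≡⟨ ^-*-assoc 2 q A ⟩
      2 ^ (q * A)           ≡⟨ cong (2 ^_) (*-comm q A) ⟩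
      2 ^ (A * q)           <⟨ ^-monoʳ-< 2 ≤-refl (≤-<-trans (*-monoʳ-≤ A (n≤1+n q)) A[1+q]<Q) ⟩
      2 ^ Q                 ∎

    n^g≤2^Q : n ^ g ≤ 2 ^ Q
    n^g≤2^Q = ≤-trans (^-monoʳ-≤ n g≤β) (<⇒≤ n^β<2^Q)

    n^[1+g]≤Q^B : n ^ suc g ≤ Q ^ B
    n^[1+g]≤Q^B = begin
      n ^ suc g             ≤⟨ ^-monoˡ-≤ (suc g) n≤Q^[1+L] ⟩
      (Q ^ suc L) ^ suc g   ≡⟨ ^-*-assoc Q (suc L) (suc g) ⟩
      Q ^ B                 ∎

    θQ≤n : β * (2 * (Q * Q)) * τ * Q ≤ n
    θQ≤n = begin
      β * (2 * (Q * Q)) * τ * Q    ≡⟨ rearrange β Q τ ⟩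
      2 * β * (Q * (Q * (Q * τ)))  ≤⟨ *-monoˡ-≤ _ 2β≤Q ⟩
      Q ^ (4 + (6 * c′ + 2))       ≡⟨ cong (Q ^_) (exponent c′) ⟩
      Q ^ L                        ≤⟨ Q^L≤n ⟩
      n                            ∎
      where
      rearrange : ∀ b q t → b * (2 * (q * q)) * t * q ≡ 2 * b * (q * (q * (q * t)))
      rearrange = solve-∀
      exponent : ∀ c → 4 + (6 * c + 2) ≡ 6 * suc c
      exponent = solve-∀

    2Qτ≤n : 2 * (Q * τ) ≤ n
    2Qτ≤n = begin
      2 * (Q * τ)                  ≤⟨ *-monoˡ-≤ (Q * τ) 2≤Q ⟩
      Q ^ (2 + (6 * c′ + 2))       ≤⟨ ^-monoʳ-≤ Q (≤-trans (m≤n+m _ 2) (≤-reflexive (exponent c′))) ⟩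
      Q ^ L                        ≤⟨ Q^L≤n ⟩
      n                            ∎
      where
      exponent : ∀ c → 2 + (2 + (6 * c + 2)) ≡ 6 * suc c
      exponent = solve-∀

    nQ≤Q^[2+L] : n * Q ≤ Q ^ (2 + L)
    nQ≤Q^[2+L] = ≤-trans (*-monoˡ-≤ Q n≤Q^[1+L]) (≤-reflexive (*-comm (Q ^ suc L) Q))

    module _ {m : ℕ} (m≤ : m ≤ Q ^ (2 + L)) where

      2m^c≤τ^c*m : 2 * m ^ c ≤ τ ^ c * m
      2m^c≤τ^c*m = begin
        2 * (m * m ^ c′)                  ≡⟨ rearrange m (m ^ c′) ⟩
        2 * m ^ c′ * m                    ≤⟨ *-monoˡ-≤ m (*-mono-≤ 2≤Q (^-monoˡ-≤ c′ m≤)) ⟩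
        Q * (Q ^ (2 + L)) ^ c′ * m        ≡⟨ cong (λ e → Q * e * m) (^-*-assoc Q (2 + L) c′) ⟩
        Q ^ suc ((2 + L) * c′) * m        ≤⟨ *-monoˡ-≤ m (^-monoʳ-≤ Q (≤-trans (n≤1+n _) (≤-reflexive (exponent c′)))) ⟩
        Q ^ ((6 * c′ + 2) * c) * m        ≡⟨ cong (_* m) (^-*-assoc Q (6 * c′ + 2) c) ⟨
        τ ^ c * m                         ∎
        where
        rearrange : ∀ m x → 2 * (m * x) ≡ 2 * x * m
        rearrange = solve-∀
        exponent : ∀ c → suc (suc ((2 + 6 * suc c) * c)) ≡ (6 * c + 2) * suc c
        exponent = solve-∀

      2cnm*n^g≤Q^T : 2 * c * n * m * n ^ g ≤ Q ^ T
      2cnm*n^g≤Q^T = begin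
        2 * c * n * m * n ^ g             ≡⟨ rearrange c n m (n ^ g) ⟩
        n ^ suc g * (2 * c * m)           ≤⟨ *-mono-≤ n^[1+g]≤Q^B (*-mono-≤ (≤-trans (*-monoʳ-≤ 2 c≤β) 2β≤Q) m≤) ⟩
        Q ^ B * Q ^ (3 + L)               ≡⟨ ^-distribˡ-+-* Q B (3 + L) ⟨
        Q ^ (B + (3 + L))                 ≡⟨ cong (λ e → Q ^ (B + e)) (+-comm 3 L) ⟩
        Q ^ T                             ∎
        where
        rearrange : ∀ c n m x → 2 * c * n * m * x ≡ n * x * (2 * c * m)
        rearrange = solve-∀

-- Counting over encoded functions

∑-allFin-+ : ∀ j k (f : Fin (j + k) → ℕ) →
  ∑ (allFin (j + k)) f ≡ ∑ (allFin j) (f ∘ (_↑ˡ k)) + ∑ (allFin k) (f ∘ (j ↑ʳ_))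
∑-allFin-+ zero    k f = refl
∑-allFin-+ (suc j) k f = begin
  ∑ (allFin (suc j + k)) f                      ≡⟨ ∑-allFin-suc (j + k) f ⟩
  f zero + ∑ (allFin (j + k)) (f ∘ suc)         ≡⟨ cong (f zero +_) (∑-allFin-+ j k (f ∘ suc)) ⟩
  f zero + (∑ (allFin j) (f ∘ suc ∘ (_↑ˡ k)) + ∑ (allFin k) (f ∘ (suc j ↑ʳ_))) ≡⟨ +-assoc (f zero) _ _ ⟨
  f zero + ∑ (allFin j) (f ∘ suc ∘ (_↑ˡ k)) + ∑ (allFin k) (f ∘ (suc j ↑ʳ_))   ≡⟨ cong (_+ ∑ (allFin k) (f ∘ (suc j ↑ʳ_))) (∑-allFin-suc j (f ∘ (_↑ˡ k))) ⟨
  ∑ (allFin (suc j)) (f ∘ (_↑ˡ k)) + ∑ (allFin k) (f ∘ (suc j ↑ʳ_))            ∎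
  where open ≡-Reasoning

∑-combine : ∀ j k (f : Fin (j * k) → ℕ) →
  ∑ (allFin (j * k)) f ≡ (∑[ a ∈ allFin j ] ∑[ b ∈ allFin k ] f (combine a b))
∑-combine zero    k f = refl
∑-combine (suc j) k f = begin
  ∑ (allFin (k + j * k)) f                                                      ≡⟨ ∑-allFin-+ k (j * k) f ⟩
  ∑ (allFin k) (f ∘ (_↑ˡ (j * k))) + ∑ (allFin (j * k)) (f ∘ (k ↑ʳ_))           ≡⟨ cong (∑ (allFin k) (f ∘ (_↑ˡ (j * k))) +_) (∑-combine j k (f ∘ (k ↑ʳ_))) ⟩
  ∑ (allFin k) (f ∘ combine {suc j} zero) + (∑[ a ∈ allFin j ] ∑[ b ∈ allFin k ] f (combine (suc a) b)) ≡⟨ ∑-allFin-suc j _ ⟨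
  (∑[ a ∈ allFin (suc j) ] ∑[ b ∈ allFin k ] f (combine a b))                   ∎
  where open ≡-Reasoning

-- The enumeration e is arbitrary so that the lemma can be nested: first for a row as a vector of
-- bins, then for the tables as a vector of rows.
∑-finToFun : {A : Set} (xs : List A) (N : ℕ) (e : Fin N → A) → (∀ f → ∑ (allFin N) (f ∘ e) ≡ ∑ xs f) →
  ∀ k (f : Vec A k → ℕ) → (∑[ x ∈ allFin (N ^ k) ] f (tabulate (e ∘ finToFun x))) ≡ ∑ (vecs xs k) f
∑-finToFun xs N e enum zero    f = refl
∑-finToFun xs N e enum (suc k) f = begin
  (∑[ x ∈ allFin (N * N ^ k) ] f (tabulate (e ∘ finToFun x)))                                        ≡⟨ ∑-combine N (N ^ k) _ ⟩
  (∑[ a ∈ allFin N ] ∑[ b ∈ allFin (N ^ k) ] f (tabulate (e ∘ finToFun (combine {N} {N ^ k} a b))))  ≡⟨ ∑-cong (allFin N) (λ a → ∑-cong (allFin (N ^ k)) λ b → cong f (unfold a b)) ⟩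
  (∑[ a ∈ allFin N ] ∑[ b ∈ allFin (N ^ k) ] f (e a ∷ tabulate (e ∘ finToFun b)))                    ≡⟨ ∑-cong (allFin N) (λ a → ∑-finToFun xs N e enum k (f ∘ (e a ∷_))) ⟩
  (∑[ a ∈ allFin N ] ∑[ v ∈ vecs xs k ] f (e a ∷ v))                                                 ≡⟨ enum (λ a → ∑[ v ∈ vecs xs k ] f (a ∷ v)) ⟩
  (∑[ a ∈ xs ] ∑[ v ∈ vecs xs k ] f (a ∷ v))                                                         ≡⟨ ∑-vecs-suc xs k f ⟨
  ∑ (vecs xs (suc k)) f                                                                              ∎
  where
  open ≡-Reasoning
  unfold : ∀ a b → tabulate (e ∘ finToFun {N} {suc k} (combine a b)) ≡ e a ∷ tabulate (e ∘ finToFun b)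
  unfold a b = cong₂ _∷_ (cong (e ∘ proj₁) (Fin.remQuot-combine a b))
    (tabulate-cong λ i → cong (λ p → e (finToFun (proj₂ p) i)) (Fin.remQuot-combine {N} a b))

funToFin-cong : ∀ {k j} {f g : Fin k → Fin j} → (∀ i → f i ≡ g i) → funToFin f ≡ funToFin g
funToFin-cong {zero}  e = refl
funToFin-cong {suc k} e = cong₂ combine (e zero) (funToFin-cong (e ∘ suc))

∣tabulate∣ : ∀ {k} {P : Pred (Fin k) 0ℓ} (P? : Decidable P) →
  ∣ tabulate (does ∘ P?) ∣ ≡ (∑[ y ∈ allFin k ] 𝟙 (P? y))
∣tabulate∣ {zero}  P? = refl
∣tabulate∣ {suc k} P? = trans (helper (does (P? zero)) refl) (sym (∑-allFin-suc k (𝟙 ∘ P?)))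
  where
  rest = ∑[ y ∈ allFin k ] 𝟙 (P? (suc y))
  helper : ∀ b → does (P? zero) ≡ b → ∣ does (P? zero) ∷ tabulate (does ∘ P? ∘ suc) ∣ ≡ 𝟙 (P? zero) + rest
  helper true  eq rewrite eq = cong suc (∣tabulate∣ (P? ∘ suc))
  helper false eq rewrite eq = ∣tabulate∣ (P? ∘ suc)

∣p∣≡∑ : ∀ {k} (p : Subset k) → ∣ p ∣ ≡ (∑[ x ∈ allFin k ] 𝟙 (x ∈? p))
∣p∣≡∑ {k} [] = refl
∣p∣≡∑ {suc k} (inside  ∷ p) = trans (cong suc (∣p∣≡∑ p)) (sym (∑-allFin-suc k λ x → 𝟙 (x ∈? inside ∷ p)))
∣p∣≡∑ {suc k} (outside ∷ p) = trans (∣p∣≡∑ p) (sym (∑-allFin-suc k λ x → 𝟙 (x ∈? outside ∷ p)))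

∃-⊆ : ∀ {k} (p : Subset k) j → j ≤ ∣ p ∣ → ∃[ p′ ] (p′ ⊆ p × ∣ p′ ∣ ≡ j)
∃-⊆ []            zero    le = [] , id , refl
∃-⊆ (outside ∷ p) j       le with ∃-⊆ p j le
... | p′ , p′⊆p , eq = outside ∷ p′ , out⊆ p′⊆p , eq
∃-⊆ (inside ∷ p)  zero    le with ∃-⊆ p zero z≤n
... | p′ , p′⊆p , eq = outside ∷ p′ , out⊆ p′⊆p , eq
∃-⊆ (inside ∷ p)  (suc j) le with ∃-⊆ p j (s≤s⁻¹ le)
... | p′ , p′⊆p , eq = inside ∷ p′ , s⊆s p′⊆p , cong suc eq

-- The encoded hash function as an instance of `Hashing`

xor₂-assoc : ∀ a b c → xor₂ (xor₂ a b) c ≡ xor₂ a (xor₂ b c)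
xor₂-assoc zero       zero       zero       = refl
xor₂-assoc zero       zero       (suc zero) = refl
xor₂-assoc zero       (suc zero) zero       = refl
xor₂-assoc zero       (suc zero) (suc zero) = refl
xor₂-assoc (suc zero) zero       zero       = refl
xor₂-assoc (suc zero) zero       (suc zero) = refl
xor₂-assoc (suc zero) (suc zero) zero       = refl
xor₂-assoc (suc zero) (suc zero) (suc zero) = refl

xor₂-comm : ∀ a b → xor₂ a b ≡ xor₂ b a
xor₂-comm zero       zero       = refl
xor₂-comm zero       (suc zero) = refl
xor₂-comm (suc zero) zero       = refl
xor₂-comm (suc zero) (suc zero) = refl

xor₂-identityˡ : ∀ a → xor₂ zero a ≡ a
xor₂-identityˡ zero       = refl
xor₂-identityˡ (suc zero) = refl

xor₂-self : ∀ a → xor₂ a a ≡ zero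
xor₂-self zero       = refl
xor₂-self (suc zero) = refl

module _ (c σ r : ℕ) where
  open Tabulation c σ r

  private
    bit : ∀ v w k → finToFun (v ⊕ w) k ≡ xor₂ (finToFun v k) (finToFun w k)
    bit v w = Fin.finToFun-funToFin {r} (λ k → xor₂ (finToFun v k) (finToFun w k))

  ⊕-assoc : ∀ x y z → (x ⊕ y) ⊕ z ≡ x ⊕ (y ⊕ z)
  ⊕-assoc x y z = funToFin-cong {r} λ k → begin
    xor₂ (finToFun (x ⊕ y) k) (finToFun z k)                   ≡⟨ cong (λ b → xor₂ b (finToFun z k)) (bit x y k) ⟩
    xor₂ (xor₂ (finToFun x k) (finToFun y k)) (finToFun z k)   ≡⟨ xor₂-assoc (finToFun x k) _ _ ⟩
    xor₂ (finToFun x k) (xor₂ (finToFun y k) (finToFun z k))   ≡⟨ cong (xor₂ (finToFun x k)) (bit y z k) ⟨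
    xor₂ (finToFun x k) (finToFun (y ⊕ z) k)                   ∎
    where open ≡-Reasoning

  ⊕-comm : ∀ x y → x ⊕ y ≡ y ⊕ x
  ⊕-comm x y = funToFin-cong {r} λ k → xor₂-comm (finToFun x k) (finToFun y k)

  ⊕-identityˡ : ∀ x → 0ₙ ⊕ x ≡ x
  ⊕-identityˡ x = trans (funToFin-cong {r} λ k →
      trans (cong (λ b → xor₂ b (finToFun x k)) (Fin.finToFun-funToFin {r} (λ _ → zero) k)) (xor₂-identityˡ _))
    (Fin.funToFin-finToFin {r} x)

  ⊕-self : ∀ x → x ⊕ x ≡ 0ₙ
  ⊕-self x = funToFin-cong {r} λ k → xor₂-self (finToFun x k)

  open Hashing n _⊕_ 0ₙ ⊕-assoc ⊕-comm ⊕-identityˡ ⊕-self σ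

  key : Fin u → Key c
  key x = tabulate (finToFun x)

  key⁻¹ : Key c → Fin u
  key⁻¹ x = funToFin (lookup x)

  key-key⁻¹ : ∀ x → key (key⁻¹ x) ≡ x
  key-key⁻¹ x = trans (tabulate-cong (Fin.finToFun-funToFin (lookup x))) (tabulate∘lookup x)

  key⁻¹-key : ∀ x → key⁻¹ (key x) ≡ x
  key⁻¹-key x = trans (funToFin-cong {c} (lookup∘tabulate (finToFun x))) (Fin.funToFin-finToFin {c} x)

  weight : Subset u → Key c → ℕ
  weight X x = 𝟙 (key⁻¹ x ∈? X)

  ∑-weight : ∀ X → ∑ (keys c) (weight X) ≡ ∣ X ∣
  ∑-weight X = begin
    ∑ (keys c) (weight X)                      ≡⟨ ∑-finToFun chars σ id (λ _ → refl) c (weight X) ⟨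
    (∑[ x ∈ allFin u ] weight X (key x))       ≡⟨ ∑-cong (allFin u) (λ x → cong (λ x → 𝟙 (x ∈? X)) (key⁻¹-key x)) ⟩
    (∑[ x ∈ allFin u ] 𝟙 (x ∈? X))             ≡⟨ ∣p∣≡∑ X ⟨
    ∣ X ∣                                      ∎
    where open ≡-Reasoning

  tables′ : Fin |Ω| → Tables c
  tables′ ω = tabulate (λ i → tabulate (tables ω i))

  ∑-tables′ : (f : Tables c → ℕ) → (∑[ ω ∈ allFin |Ω| ] f (tables′ ω)) ≡ ∑ (tabs c) f
  ∑-tables′ = ∑-finToFun rows (n ^ σ) (tabulate ∘ finToFun) (∑-finToFun bins n id (λ _ → refl) σ) c

  foldr≡H : ∀ {k} (t : Fin k → Fin σ → Fin n) (x : Fin k → Fin σ) →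
    foldr _⊕_ 0ₙ (λ i → t i (x i)) ≡ H (tabulate (tabulate ∘ t)) (tabulate x)
  foldr≡H {zero}  t x = refl
  foldr≡H {suc k} t x = cong₂ _⊕_ (sym (lookup∘tabulate (t zero) (x zero))) (foldr≡H (t ∘ suc) (x ∘ suc))

  -- A positive load yields a key of X as witness, so every bin is in the image or counted by
  -- `empty`. An upper bound on `empty` thus carries over to n - |h(X)|.
  n≤∣image∣+empty : ∀ ω X → n ≤ ∣ image (h ω) X ∣ + empty (tables′ ω) (weight X)
  n≤∣image∣+empty ω X = begin
    n                                                         ≡⟨ trans (∑-allFin-const n 1) (*-identityʳ n) ⟨
    (∑[ y ∈ bins ] 1)                                         ≤⟨ ∑-mono bins pointwise ⟩
    (∑[ y ∈ bins ] (𝟙 (hit? y) + (1 ∸ load ts w y)))          ≡⟨ ∑-distrib-+ bins _ _ ⟩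
    (∑[ y ∈ bins ] 𝟙 (hit? y)) + empty ts w                   ≡⟨ cong (_+ empty ts w) (∣tabulate∣ hit?) ⟨
    ∣ image (h ω) X ∣ + empty ts w                            ∎
    where
    open ≤-Reasoning
    ts = tables′ ω
    w = weight X
    hit? : ∀ y → Dec (∃[ x ] (x ∈ₛ X × h ω x ≡ y))
    hit? y = Fin.any? λ x → (x ∈? X) ×-dec (h ω x Fin.≟ y)
    hit : ∀ y → 0 < load ts w y → ∃[ x ] (x ∈ₛ X × h ω x ≡ y)
    hit y 0<load with 0<∑⇒∃ (keys c) _ 0<load
    ... | x , pos with key⁻¹ x ∈? X | H ts x Fin.≟ y
    ...   | yes x∈X | yes eq = key⁻¹ x , x∈X , trans (foldr≡H (tables ω) (finToFun (key⁻¹ x))) (trans (cong (H ts) (key-key⁻¹ x)) eq)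
    pointwise : ∀ y → 1 ≤ 𝟙 (hit? y) + (1 ∸ load ts w y)
    pointwise y with load ts w y in eq
    ... | zero  = m≤n+m 1 _
    ... | suc k = ≤-trans (≤-reflexive (sym (𝟙-yes (hit? y) (hit y (subst (0 <_) (sym eq) z<s))))) (m≤m+n _ _)

-- Tail bound for sets of every size

module _ (c′ g σ r : ℕ) (r₀≤r : Parameters.r₀ c′ g ≤ r) where

  open Parameters c′ g hiding (n; q; Q; τ; n≢0; Q≢0; τ≢0)

  open Tabulation c σ r using (n; 0ₙ; _⊕_)
  open Hashing n {{m^n≢0 2 r}} _⊕_ 0ₙ (⊕-assoc c σ r) (⊕-comm c σ r) (⊕-identityˡ c σ r) (⊕-self c σ r) σ

  private
    Q τ : ℕ
    Q = Parameters.Q c′ g r r₀≤r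
    τ = Parameters.τ c′ g r r₀≤r

    instance
      n≢0 : NonZero n
      n≢0 = m^n≢0 2 r
      Q≢0 : NonZero Q
      Q≢0 = Parameters.Q≢0 c′ g r r₀≤r
      τ≢0 : NonZero τ
      τ≢0 = Parameters.τ≢0 c′ g r r₀≤r

  -- At n/2Q the two regimes meet: up to there the load bound applies to Y as a whole, and beyond it
  -- m is large enough for the exponential decay to reach 2^(-Q).
  bounded-tail : ∀ Y → ∣ Y ∣ ≤ Q ^ (2 + L) →
    (∑[ ts ∈ tabs c ] 𝟙 (large? β ∣ Y ∣ (empty ts (weight c σ r Y)))) * n ^ g ≤ 2 * N ^ c
  bounded-tail Y m≤ with 2 * (Q * ∣ Y ∣) ≤? n
  ... | yes 2Qm≤n = ≤-trans (few-keys (θQ≤n r r₀≤r) (n^g≤2^Q r r₀≤r) (n^[1+g]≤Q^B r r₀≤r) w w≤1 ∣ Y ∣ (∑-weight c σ r Y)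
      (2cnm*n^g≤Q^T r r₀≤r m≤) 2Qm≤n) (m≤m+n _ _)
    where
    open Tail c g Q T B τ (2≤n r r₀≤r) 2≤B using (few-keys)
    w = weight c σ r Y
    w≤1 : ∀ x → w x ≤ 1
    w≤1 x = 𝟙≤1 (key⁻¹ c σ r x ∈? Y)
  ... | no n<2Qm = many-keys (θQ≤n r r₀≤r) (n^g≤2^Q r r₀≤r) (n^[1+g]≤Q^B r r₀≤r) w w≤1 ∣ Y ∣ (∑-weight c σ r Y)
      (2cnm*n^g≤Q^T r r₀≤r m≤) (2m^c≤τ^c*m r r₀≤r m≤) (2Qτ≤n r r₀≤r) (≰⇒≥ n<2Qm)
    where
    open Tail c g Q T B τ (2≤n r r₀≤r) 2≤B using (many-keys)
    w = weight c σ r Y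
    w≤1 : ∀ x → w x ≤ 1
    w≤1 x = 𝟙≤1 (key⁻¹ c σ r x ∈? Y)

  -- With more than Q^(2+L) keys, a subset of that size already leaves no bin empty.
  tail : ∀ X → (∑[ ts ∈ tabs c ] 𝟙 (large? β ∣ X ∣ (empty ts (weight c σ r X)))) * n ^ g ≤ 2 * N ^ c
  tail X with ∣ X ∣ ≤? Q ^ (2 + L)
  ... | yes m≤ = bounded-tail X m≤
  ... | no  m≰ with ∃-⊆ X (Q ^ (2 + L)) (≰⇒≥ m≰)
  ...   | Y , Y⊆X , ∣Y∣≡ = ≤-trans (*-monoˡ-≤ (n ^ g) (∑-mono (tabs c) pointwise)) (bounded-tail Y (≤-reflexive ∣Y∣≡))
    where
    open ≤-Reasoning
    M = Q ^ (2 + L)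
    -- With M ≥ n Q keys, (1 - 1/n)^M ≤ 2^(-Q) < n^(-β), so the target is below 1 and one empty bin
    -- is already a failure. A failing X leaves some bin empty, and that bin is empty for Y ⊆ X as
    -- well.
    0<e⇒large : ∀ e → 0 < e → Large β M e
    0<e⇒large e 0<e = begin-strict
      n ^ β * (n ∸ 1) ^ M    <⟨ *-monoˡ-< ((n ∸ 1) ^ M) {{m^n≢0 (n ∸ 1) M {{>-nonZero (∸-monoˡ-≤ 1 (2≤n r r₀≤r))}}}} (n^β<2^Q r r₀≤r) ⟩
      2 ^ Q * (n ∸ 1) ^ M    ≡⟨ *-comm (2 ^ Q) _ ⟩
      (n ∸ 1) ^ M * 2 ^ Q    ≤⟨ [n∸1]^j*2^q≤n^j n Q (nQ≤Q^[2+L] r r₀≤r) ⟩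
      n ^ M                  ≤⟨ m≤n*m (n ^ M) (e ^ β) {{m^n≢0 e β {{>-nonZero 0<e}}}} ⟩
      e ^ β * n ^ M          ∎
    large⇒0<e : ∀ m e → Large β m e → 0 < e
    large⇒0<e m (suc e) _     = z<s
    large⇒0<e m zero    large = contradiction (subst (λ e → n ^ β * (n ∸ 1) ^ m < e * n ^ m) (0^k≡0 β) large) λ ()
    w≤w : ∀ x → weight c σ r Y x ≤ weight c σ r X x
    w≤w x = 𝟙-≤ (key⁻¹ c σ r x ∈? Y) λ x∈Y → ≤-reflexive (sym (𝟙-yes (key⁻¹ c σ r x ∈? X) (Y⊆X x∈Y)))
    pointwise : ∀ ts → 𝟙 (large? β ∣ X ∣ (empty ts (weight c σ r X))) ≤ 𝟙 (large? β ∣ Y ∣ (empty ts (weight c σ r Y)))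
    pointwise ts = 𝟙-≤ (large? β ∣ X ∣ (empty ts (weight c σ r X))) λ large →
      ≤-reflexive (sym (𝟙-yes (large? β ∣ Y ∣ (empty ts (weight c σ r Y))) (subst (λ m → Large β m (empty ts (weight c σ r Y))) (sym ∣Y∣≡)
        (0<e⇒large _ (≤-trans (large⇒0<e ∣ X ∣ _ large) (∑-mono bins λ y → ∸-monoʳ-≤ 1 (load-mono ts w≤w y)))))))

-- Rational numbers as fractions of natural numbers

open import Data.Integer.Base using (+_; -[1+_])

fromℕ≡mkℚ : ∀ k → fromℕ k ≡ mkℚ (+ k) 0 (coprime-sym (1-coprimeTo k))
fromℕ≡mkℚ k = ℚ.normalize-coprime (coprime-sym (1-coprimeTo k))

fromℕ-* : ∀ a b → fromℕ (a * b) ≡ fromℕ a ℚ.* fromℕ b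
fromℕ-* a b rewrite fromℕ≡mkℚ a | fromℕ≡mkℚ b = cong (ℚ._/ 1) (ℤ.pos-* a b)

fromℕ-+ : ∀ a b → fromℕ (a + b) ≡ fromℕ a ℚ.+ fromℕ b
fromℕ-+ a b rewrite fromℕ≡mkℚ a | fromℕ≡mkℚ b =
  cong (ℚ._/ 1) (sym (cong₂ ℤ._+_ (ℤ.*-identityʳ (+ a)) (ℤ.*-identityʳ (+ b))))

fromℕ-mono-≤ : ∀ {a b} → a ≤ b → fromℕ a ℚ.≤ fromℕ b
fromℕ-mono-≤ {a} {b} a≤b rewrite fromℕ≡mkℚ a | fromℕ≡mkℚ b = ℚ.*≤* (ℤ.*-monoʳ-≤-nonNeg (+ 1) (ℤ.+≤+ a≤b))

fromℕ-injective : ∀ {a b} → fromℕ a ≡ fromℕ b → a ≡ b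
fromℕ-injective {a} {b} eq = ℤ.+-injective (begin
  + a             ≡⟨ cong ↥_ (fromℕ≡mkℚ a) ⟨
  ↥ (fromℕ a)     ≡⟨ cong ↥_ eq ⟩
  ↥ (fromℕ b)     ≡⟨ cong ↥_ (fromℕ≡mkℚ b) ⟩
  + b             ∎)
  where open ≡-Reasoning

fromℕ-pos : ∀ a .{{_ : NonZero a}} → Positive (fromℕ a)
fromℕ-pos a = ℚ.normalize-pos a 1

-- a / s as a possibly unreduced fraction.
record _≈_÷_ (x : ℚ) (a s : ℕ) : Set where
  constructor fraction
  field cleared : x ℚ.* fromℕ s ≡ fromℕ a

fromℕ-≈ : ∀ a → fromℕ a ≈ a ÷ 1
fromℕ-≈ a = fraction (ℚ.*-identityʳ (fromℕ a))

1-≈ : ∀ s → 1ℚ ≈ s ÷ s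
1-≈ s = fraction (ℚ.*-identityˡ (fromℕ s))

/-≈ : ∀ a s .{{_ : NonZero s}} → (+ a ℚ./ s) ≈ a ÷ s
/-≈ a (suc s) = fraction $ ℚ.toℚᵘ-injective (begin
  toℚᵘ ((+ a ℚ./ suc s) ℚ.* fromℕ (suc s))             ≈⟨ ℚ.toℚᵘ-homo-* (+ a ℚ./ suc s) (fromℕ (suc s)) ⟩
  toℚᵘ (+ a ℚ./ suc s) ℚᵘ.* toℚᵘ (fromℕ (suc s))       ≈⟨ ℚᵘ.*-cong (ℚ.toℚᵘ-fromℚᵘ (ℚᵘ.mkℚᵘ (+ a) s)) (ℚ.toℚᵘ-fromℚᵘ (ℚᵘ.mkℚᵘ (+ suc s) 0)) ⟩
  ℚᵘ.mkℚᵘ (+ a) s ℚᵘ.* ℚᵘ.mkℚᵘ (+ suc s) 0             ≈⟨ ℚᵘ.*≡* (trans (ℤ.*-identityʳ _) (cong (λ d → + a ℤ.* + suc d) (sym (*-identityʳ s)))) ⟩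
  ℚᵘ.mkℚᵘ (+ a) 0                                      ≈⟨ ℚ.toℚᵘ-fromℚᵘ (ℚᵘ.mkℚᵘ (+ a) 0) ⟨
  toℚᵘ (fromℕ a)                                       ∎)
  where open import Relation.Binary.Reasoning.Setoid ℚᵘ.≃-setoid

*-≈ : ∀ {x y a b s t} → x ≈ a ÷ s → y ≈ b ÷ t → (x ℚ.* y) ≈ a * b ÷ (s * t)
*-≈ {x} {y} {a} {b} {s} {t} (fraction p) (fraction q) = fraction $ begin
  x ℚ.* y ℚ.* fromℕ (s * t)               ≡⟨ cong (x ℚ.* y ℚ.*_) (fromℕ-* s t) ⟩
  x ℚ.* y ℚ.* (fromℕ s ℚ.* fromℕ t)       ≡⟨ interchange x y (fromℕ s) (fromℕ t) ⟩
  x ℚ.* fromℕ s ℚ.* (y ℚ.* fromℕ t)       ≡⟨ cong₂ ℚ._*_ p q ⟩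
  fromℕ a ℚ.* fromℕ b                     ≡⟨ fromℕ-* a b ⟨
  fromℕ (a * b)                           ∎
  where
  open ≡-Reasoning
  open import Algebra.Properties.CommutativeSemigroup (CommutativeMonoid.commutativeSemigroup ℚ.*-1-commutativeMonoid) using (interchange)

^-≈ : ∀ {x a s} → x ≈ a ÷ s → ∀ k → (x ^ℚ k) ≈ a ^ k ÷ (s ^ k)
^-≈ p zero    = fraction refl
^-≈ p (suc k) = *-≈ p (^-≈ p k)

∸-≈ : ∀ {x y a b s} → b ≤ a → x ≈ a ÷ s → y ≈ b ÷ s → (x ℚ.- y) ≈ a ∸ b ÷ s
∸-≈ {x} {y} {a} {b} {s} b≤a (fraction p) (fraction q) = fraction $ begin
  (x ℚ.- y) ℚ.* fromℕ s                              ≡⟨ ℚ.*-distribʳ-+ (fromℕ s) x (ℚ.- y) ⟩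
  x ℚ.* fromℕ s ℚ.+ ℚ.- y ℚ.* fromℕ s                ≡⟨ cong₂ ℚ._+_ p (trans (sym (ℚ.neg-distribˡ-* y (fromℕ s))) (cong ℚ.-_ q)) ⟩
  fromℕ a ℚ.- fromℕ b                                ≡⟨ cong (ℚ._- fromℕ b) (trans (cong fromℕ (sym (m∸n+n≡m b≤a))) (fromℕ-+ (a ∸ b) b)) ⟩
  fromℕ (a ∸ b) ℚ.+ fromℕ b ℚ.- fromℕ b              ≡⟨ ℚ.+-assoc (fromℕ (a ∸ b)) (fromℕ b) (ℚ.- fromℕ b) ⟩
  fromℕ (a ∸ b) ℚ.+ (fromℕ b ℚ.- fromℕ b)            ≡⟨ cong (fromℕ (a ∸ b) ℚ.+_) (ℚ.+-inverseʳ (fromℕ b)) ⟩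
  fromℕ (a ∸ b) ℚ.+ 0ℚ                               ≡⟨ ℚ.+-identityʳ _ ⟩
  fromℕ (a ∸ b)                                      ∎
  where open ≡-Reasoning

≈-scaleʳ : ∀ {x a s} t → x ≈ a ÷ s → x ℚ.* fromℕ (s * t) ≡ fromℕ (a * t)
≈-scaleʳ {x} {a} {s} t (fraction p) = begin
  x ℚ.* fromℕ (s * t)              ≡⟨ cong (x ℚ.*_) (fromℕ-* s t) ⟩
  x ℚ.* (fromℕ s ℚ.* fromℕ t)      ≡⟨ ℚ.*-assoc x (fromℕ s) (fromℕ t) ⟨
  x ℚ.* fromℕ s ℚ.* fromℕ t        ≡⟨ cong (ℚ._* fromℕ t) p ⟩
  fromℕ a ℚ.* fromℕ t              ≡⟨ fromℕ-* a t ⟨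
  fromℕ (a * t)                    ∎
  where open ≡-Reasoning

≈-≤ : ∀ {x y a b s t} .{{_ : NonZero s}} .{{_ : NonZero t}} → x ≈ a ÷ s → y ≈ b ÷ t → a * t ≤ b * s → x ℚ.≤ y
≈-≤ {x} {y} {a} {b} {s} {t} p q le = ℚ.*-cancelʳ-≤-pos (fromℕ (s * t)) {{fromℕ-pos (s * t) {{m*n≢0 s t}}}}
  (subst₂ ℚ._≤_ (sym (≈-scaleʳ t p)) (sym (trans (cong (λ e → y ℚ.* fromℕ e) (*-comm s t)) (≈-scaleʳ s q)))
    (fromℕ-mono-≤ le))

≈-unique : ∀ {x a b s t} → x ≈ a ÷ s → x ≈ b ÷ t → a * t ≡ b * s
≈-unique {x} {a} {b} {s} {t} p q = fromℕ-injective (trans (sym (≈-scaleʳ t p))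
  (trans (cong (λ e → x ℚ.* fromℕ e) (*-comm s t)) (≈-scaleʳ s q)))

↥≡+∣↥∣ : ∀ {ρ} → 0ℚ ℚ.≤ ρ → ↥ ρ ≡ + ℤ.∣ ↥ ρ ∣
↥≡+∣↥∣ {mkℚ (+ _) _ _}    _   = refl
↥≡+∣↥∣ {mkℚ -[1+ _ ] _ _} 0≤ρ with () ← ℚ.nonNegative 0≤ρ

≈-↥÷↧ : ∀ {ρ} → 0ℚ ℚ.≤ ρ → ρ ≈ ℤ.∣ ↥ ρ ∣ ÷ (↧ₙ ρ)
≈-↥÷↧ {ρ} 0≤ρ = subst (λ x → x ≈ ℤ.∣ ↥ ρ ∣ ÷ (↧ₙ ρ))
  (trans (cong (ℚ._/ ↧ₙ ρ) (sym (↥≡+∣↥∣ 0≤ρ))) (ℚ.↥p/↧p≡p ρ)) (/-≈ ℤ.∣ ↥ ρ ∣ (↧ₙ ρ))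

-- The denominator of q is at least 1, so q is at most the absolute value of its numerator. That
-- number serves as the integer exponent g above every ρ < γ.
ρ<q⇒∣↥ρ∣≤∣↥q∣*↧ρ : ∀ {ρ q} → 0ℚ ℚ.≤ ρ → ρ ℚ.< q → ℤ.∣ ↥ ρ ∣ ≤ ℤ.∣ ↥ q ∣ * ↧ₙ ρ
ρ<q⇒∣↥ρ∣≤∣↥q∣*↧ρ {ρ} {q} 0≤ρ ρ<q = ℤ.drop‿+≤+ (begin
  + a                       ≤⟨ ℤ.+≤+ (m≤m*n a (↧ₙ q)) ⟩
  + (a * ↧ₙ q)              ≡⟨ ℤ.pos-* a (↧ₙ q) ⟩
  + a ℤ.* ↧ q               ≡⟨ cong (ℤ._* ↧ q) (↥≡+∣↥∣ 0≤ρ) ⟨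
  ↥ ρ ℤ.* ↧ q               <⟨ ℚ.drop-*<* ρ<q ⟩
  ↥ q ℤ.* ↧ ρ               ≤⟨ ℤ.*-monoʳ-≤-nonNeg (↧ ρ) (i≤∣i∣ (↥ q)) ⟩
  + ℤ.∣ ↥ q ∣ ℤ.* ↧ ρ       ≡⟨ ℤ.pos-* ℤ.∣ ↥ q ∣ (↧ₙ ρ) ⟨
  + (ℤ.∣ ↥ q ∣ * ↧ₙ ρ)      ∎)
  where
  open ℤ.≤-Reasoning
  a = ℤ.∣ ↥ ρ ∣
  i≤∣i∣ : ∀ i → i ℤ.≤ + ℤ.∣ i ∣
  i≤∣i∣ (+ _)    = ℤ.≤-refl
  i≤∣i∣ -[1+ _ ] = ℤ.-≤+

L<U : ∀ (γ : ℝ) {p q} → ℝ.L γ p → ℝ.U γ q → p ℚ.< q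
L<U γ {p} {q} Lp Uq with p ℚ.<? q
... | yes p<q = p<q
... | no  p≮q with q ℚ.<? p
...   | yes q<p = contradiction (Lp , ℝ.U-closed γ q<p Uq) (ℝ.disjoint γ)
...   | no  q≮p = contradiction (Lp , subst (ℝ.U γ) (ℚ.≤-antisym (ℚ.≮⇒≥ p≮q) (ℚ.≮⇒≥ q≮p)) Uq) (ℝ.disjoint γ)

-- From counts of tables to the probability statement

module _ (c σ r : ℕ) where
  open Tabulation c σ r
  open Hashing n _⊕_ 0ₙ (⊕-assoc c σ r) (⊕-comm c σ r) (⊕-identityˡ c σ r) (⊕-self c σ r) σ

  -- The exponent m/b is stored as a reduced fraction a/D, while `Large` uses b and m. Since m D = a
  -- b, the b-th power of one inequality is the D-th power of the other, and the b-th root is taken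
  -- at the end.
  ¬large⇒LargeImage : ∀ b .{{_ : NonZero b}} .{{_ : Positive (fromℕ b)}} X ω →
    ¬ Large b ∣ X ∣ (empty (tables′ c σ r ω) (weight c σ r X)) → LargeImage (fromℕ b) ∣ X ∣ X ω
  ¬large⇒LargeImage b {{_}} {{b>0}} X ω ¬large = ≈-≤
    {{m^n≢0 1 D}} {{m*n≢0 (1 ^ D) (n ^ a) {{m^n≢0 1 D}} {{m^n≢0 n a}}}}
    (^-≈ (∸-≈ i≤n (fromℕ-≈ n) (fromℕ-≈ i)) D)
    (*-≈ (^-≈ (fromℕ-≈ n) D) (^-≈ (∸-≈ (>-nonZero⁻¹ n) (1-≈ n) (/-≈ 1 n)) a))
    (subst₂ _≤_ (cong (e′ ^ D *_) (sym (trans (cong (_* n ^ a) (^-zeroˡ D)) (*-identityˡ (n ^ a)))))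
      (sym (trans (cong (n ^ D * (n ∸ 1) ^ a *_) (^-zeroˡ D)) (*-identityʳ _))) main)
    where
    open ≤-Reasoning
    m = ∣ X ∣
    e = empty (tables′ c σ r ω) (weight c σ r X)
    i = ∣ image (h ω) X ∣
    i≤n : i ≤ n
    i≤n = ∣p∣≤n (image (h ω) X)
    e′ = n ∸ i
    e′≤e : e′ ≤ e
    e′≤e = m≤n+o⇒m∸n≤o n i (n≤∣image∣+empty c σ r ω X)
    ρ : ℚ
    ρ = (fromℕ m ℚ.÷ fromℕ b) {{ℚ.pos⇒nonZero (fromℕ b)}}
    a D : ℕ
    a = ℤ.∣ ↥ ρ ∣
    D = ↧ₙ ρ
    ρ≈m÷b : ρ ≈ m ÷ b
    ρ≈m÷b = fraction $ trans (ℚ.*-assoc (fromℕ m) _ (fromℕ b))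
      (trans (cong (fromℕ m ℚ.*_) (ℚ.*-inverseˡ (fromℕ b) {{ℚ.pos⇒nonZero (fromℕ b)}})) (ℚ.*-identityʳ (fromℕ m)))
    0≤ρ : 0ℚ ℚ.≤ ρ
    0≤ρ = ≈-≤ (fromℕ-≈ 0) ρ≈m÷b z≤n
    mD≡ab : m * D ≡ a * b
    mD≡ab = ≈-unique ρ≈m÷b (≈-↥÷↧ 0≤ρ)
    raise : ∀ x y → (x ^ D * y ^ a) ^ b ≡ (x ^ b * y ^ m) ^ D
    raise x y = trans (^-distribʳ-* b (x ^ D) (y ^ a)) (trans (cong₂ _*_
        (trans (^-*-assoc x D b) (trans (cong (x ^_) (*-comm D b)) (sym (^-*-assoc x b D))))
        (trans (^-*-assoc y a b) (trans (cong (y ^_) (sym mD≡ab)) (sym (^-*-assoc y m D)))))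
      (sym (^-distribʳ-* D (x ^ b) (y ^ m))))
    main : e′ ^ D * n ^ a ≤ n ^ D * (n ∸ 1) ^ a
    main = ^-cancelʳ-≤ b (begin
      (e′ ^ D * n ^ a) ^ b           ≡⟨ raise e′ n ⟩
      (e′ ^ b * n ^ m) ^ D           ≤⟨ ^-monoˡ-≤ D (*-monoˡ-≤ (n ^ m) (^-monoˡ-≤ b e′≤e)) ⟩
      (e ^ b * n ^ m) ^ D            ≤⟨ ^-monoˡ-≤ D (≮⇒≥ ¬large) ⟩
      (n ^ b * (n ∸ 1) ^ m) ^ D      ≡⟨ raise n (n ∸ 1) ⟨
      (n ^ D * (n ∸ 1) ^ a) ^ b      ∎)

  -- It suffices to bound the number of failures with an integer exponent g > γ.
  failures⇒≥1- : ∀ {b m} .{{_ : Positive (fromℕ b)}} k (X : Subset u) (γ : ℝ) {q} → ℝ.U γ q →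
    (|Ω| ∸ length (filter (largeImage? (fromℕ b) m X) (allFin |Ω|))) * n ^ ℤ.∣ ↥ q ∣ ≤ k * |Ω| →
    Pr (largeImage? (fromℕ b) m X) ≥1- fromℕ k ·n^- γ
  failures⇒≥1- {b} {m} k X γ {q} Uq failures ρ 0≤ρ Lρ = ≈-≤
    {{m^n≢0 |Ω| D}} {{m*n≢0 (1 ^ D) (n ^ a) {{m^n≢0 1 D}} {{m^n≢0 n a}}}}
    (^-≈ (∸-≈ s≤Ω (1-≈ |Ω|) (/-≈ s |Ω|)) D)
    (*-≈ (^-≈ (fromℕ-≈ k) D) (^-≈ (/-≈ 1 n) a))
    (begin
      f ^ D * (1 ^ D * n ^ a)       ≡⟨ cong (λ x → f ^ D * (x * n ^ a)) (^-zeroˡ D) ⟩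
      f ^ D * (1 * n ^ a)           ≡⟨ cong (f ^ D *_) (*-identityˡ (n ^ a)) ⟩
      f ^ D * n ^ a                 ≤⟨ *-monoʳ-≤ (f ^ D) (^-monoʳ-≤ n (ρ<q⇒∣↥ρ∣≤∣↥q∣*↧ρ {ρ} {q} 0≤ρ (L<U γ Lρ Uq))) ⟩
      f ^ D * n ^ (g * D)           ≡⟨ cong (f ^ D *_) (^-*-assoc n g D) ⟨
      f ^ D * (n ^ g) ^ D           ≡⟨ ^-distribʳ-* D f (n ^ g) ⟨
      (f * n ^ g) ^ D               ≤⟨ ^-monoˡ-≤ D failures ⟩
      (k * |Ω|) ^ D                 ≡⟨ ^-distribʳ-* D k |Ω| ⟩
      k ^ D * |Ω| ^ D               ≡⟨ cong (_* |Ω| ^ D) (*-identityʳ (k ^ D)) ⟨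
      k ^ D * 1 * |Ω| ^ D           ≡⟨ cong (λ x → k ^ D * x * |Ω| ^ D) (^-zeroˡ a) ⟨
      k ^ D * 1 ^ a * |Ω| ^ D       ∎)
    where
    open ≤-Reasoning
    g a D s f : ℕ
    g = ℤ.∣ ↥ q ∣
    a = ℤ.∣ ↥ ρ ∣
    D = ↧ₙ ρ
    s = length (filter (largeImage? (fromℕ b) m X) (allFin |Ω|))
    f = |Ω| ∸ s
    s≤Ω : s ≤ |Ω|
    s≤Ω = ≤-trans (length-filter-≤ (largeImage? (fromℕ b) m X) (allFin |Ω|)) (≤-reflexive (length-allFin |Ω|))

  #failures : ℕ → Subset u → ℕ
  #failures β X = ∑[ ts ∈ tabs c ] 𝟙 (large? β ∣ X ∣ (empty ts (weight c σ r X)))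

  #failures≤|Ω| : ∀ β X → #failures β X ≤ |Ω|
  #failures≤|Ω| β X = begin
    #failures β X            ≤⟨ ∑-mono (tabs c) (λ ts → 𝟙≤1 (large? β ∣ X ∣ (empty ts (weight c σ r X)))) ⟩
    (∑[ _ ∈ tabs c ] 1)      ≡⟨ length≡∑1 (tabs c) ⟨
    length (tabs c)          ≡⟨ length-tabs c ⟩
    |Ω|                      ∎
    where open ≤-Reasoning

  |Ω|∸#good≤#failures : ∀ β .{{_ : NonZero β}} .{{_ : Positive (fromℕ β)}} X →
    |Ω| ∸ length (filter (largeImage? (fromℕ β) ∣ X ∣ X) (allFin |Ω|)) ≤ #failures β X
  |Ω|∸#good≤#failures β X = m≤n+o⇒m∸n≤o |Ω| (length (filter good? (allFin |Ω|))) (begin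
    |Ω|                                                               ≡⟨ trans (∑-allFin-const |Ω| 1) (*-identityʳ |Ω|) ⟨
    (∑[ ω ∈ allFin |Ω| ] 1)                                           ≤⟨ ∑-mono (allFin |Ω|) pointwise ⟩
    (∑[ ω ∈ allFin |Ω| ] (𝟙 (good? ω) + bad (tables′ c σ r ω)))       ≡⟨ ∑-distrib-+ (allFin |Ω|) _ _ ⟩
    (∑[ ω ∈ allFin |Ω| ] 𝟙 (good? ω)) + (∑[ ω ∈ allFin |Ω| ] bad (tables′ c σ r ω))
      ≡⟨ cong₂ _+_ (sym (length-filter good? (allFin |Ω|))) (∑-tables′ c σ r bad) ⟩
    length (filter good? (allFin |Ω|)) + #failures β X                ∎)
    where
    open ≤-Reasoning
    good? = largeImage? (fromℕ β) ∣ X ∣ X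
    bad? : ∀ ts → Dec (Large β ∣ X ∣ (empty ts (weight c σ r X)))
    bad? ts = large? β ∣ X ∣ (empty ts (weight c σ r X))
    bad : Tables c → ℕ
    bad ts = 𝟙 (bad? ts)
    pointwise : ∀ ω → 1 ≤ 𝟙 (good? ω) + bad (tables′ c σ r ω)
    pointwise ω = cases (bad? (tables′ c σ r ω))
      where
      cases : Dec (Large β ∣ X ∣ (empty (tables′ c σ r ω) (weight c σ r X))) → 1 ≤ 𝟙 (good? ω) + bad (tables′ c σ r ω)
      cases (yes large) = ≤-trans (≤-reflexive (sym (𝟙-yes (bad? (tables′ c σ r ω)) large))) (m≤n+m _ _)
      cases (no ¬large) = ≤-trans (≤-reflexive (sym (𝟙-yes (good? ω) (¬large⇒LargeImage β X ω ¬large)))) (m≤m+n _ _)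

-- For r below r₀ the asymptotic choices break down, but then n^g is at most (2^r₀)^g, and adding
-- this constant to k makes the bound trivial. The 2 in k covers all larger r.
∃-#failures-bound : ∀ c .{{_ : NonZero c}} g → Σ[ β ∈ ℕ ] Σ[ k ∈ ℕ ] NonZero β × NonZero k ×
  (∀ σ r X → #failures c σ r β X * (2 ^ r) ^ g ≤ k * Tabulation.|Ω| c σ r)
∃-#failures-bound (suc c′) g = β , k , β≢0 , _ , λ σ r X → cases σ r X (r₀ ≤? r)
  where
  open Parameters c′ g using (c; β; β≢0; r₀)
  k : ℕ
  k = 2 + (2 ^ r₀) ^ g
  cases : ∀ σ r X → Dec (r₀ ≤ r) → #failures c σ r β X * (2 ^ r) ^ g ≤ k * Tabulation.|Ω| c σ r
  cases σ r X (yes r₀≤r) = ≤-trans (tail c′ g σ r r₀≤r X) (*-monoˡ-≤ (Tabulation.|Ω| c σ r) (m≤m+n 2 ((2 ^ r₀) ^ g)))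
  cases σ r X (no r₀≰r) = begin
    #failures c σ r β X * (2 ^ r) ^ g    ≤⟨ *-mono-≤ (#failures≤|Ω| c σ r β X) (^-monoˡ-≤ g (^-monoʳ-≤ 2 (≰⇒≥ r₀≰r))) ⟩
    |Ω| * (2 ^ r₀) ^ g                   ≡⟨ *-comm |Ω| ((2 ^ r₀) ^ g) ⟩
    (2 ^ r₀) ^ g * |Ω|                   ≤⟨ *-monoˡ-≤ |Ω| (m≤n+m ((2 ^ r₀) ^ g) 2) ⟩
    k * |Ω|                              ∎
    where
    open ≤-Reasoning
    open Tabulation c σ r using (|Ω|)

theorem2 : (c : ℕ) .{{_ : NonZero c}} (γ : ℝ) → 0<ℝ γ →
    Σ[ β ∈ ℚ ] Σ[ β>0 ∈ Positive β ] Σ[ K ∈ ℚ ] Σ[ K>0 ∈ Positive K ]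
    ((σ r m : ℕ) → let open Tabulation c σ r in
    (X : Subset u) → ∣ X ∣ ≡ m →
    Pr (largeImage? β {{β>0}} m X) ≥1- K ·n^- γ)
theorem2 c γ _ =
  -- Any rational upper bound of γ will do: it depends on γ alone, so β and k depend only on γ and
  -- c.
  let q , Uq = ℝ.U-inhabited γ
      β , k , β≢0 , k≢0 , bound = ∃-#failures-bound c ℤ.∣ ↥ q ∣
      β>0 = fromℕ-pos β {{β≢0}}
  in fromℕ β , β>0 , fromℕ k , fromℕ-pos k {{k≢0}} , λ { σ r _ X refl →
    failures⇒≥1- c σ r {β} {∣ X ∣} {{β>0}} k X γ Uq
      (≤-trans (*-monoˡ-≤ ((2 ^ r) ^ ℤ.∣ ↥ q ∣) (|Ω|∸#good≤#failures c σ r β {{β≢0}} {{β>0}} X)) (bound σ r X)) }
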